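{- Let $n>1$ be an odd integer, and let $\zeta\in\mathbb C$ be a primitive $n$th root of unity. For $j,k=1,\ldots,n$ define $$a_{jk}=\begin{cases}(1+\zeta^{j-k})/(1-\zeta^{j-k})&\text{if}\ j\neq k,\\0&\text{if}\ j=k.\end{cases}$$ Then for every $x\in\mathbb C$, $$\det[x+a_{jk}]_{1\leqslant j,k\leqslant n-1}=(-1)^{\frac{n-1}{2}}\frac{((n-2)!!)^2}{n}.$$ In particular (the case $x=0$), $$\sum_{\tau\in D(n-1)}\mathrm{sign}(\tau)\prod_{j=1}^{n-1}\frac{1+\zeta^{j-\tau(j)}}{1-\zeta^{j-\tau(j)}}=(-1)^{\frac{n-1}{2}}\frac{((n-2)!!)^2}{n}.$$
   Context: $D(m)$ denotes the set of all derangements of $1,\ldots,m$, i.e. permutations $\tau$ of $\{1,\ldots,m\}$ with $\tau(j)\neq j$ for all $j$. For odd $m$, $m!!$ denotes the product of all odd positive integers up to $m$ (with $1!!=1$). $\mathrm{sign}(\tau)$ is the sign of the permutation $\tau$. -}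

module Defs where

open import Level using (Level; _⊔_) renaming (suc to lsuc)
open import Algebra.Bundles using (CommutativeRing)
open import Data.Nat as ℕ using (ℕ; zero; suc)
open import Data.Fin as Fin using (Fin; toℕ)
open import Data.Fin.Properties using (_≟_)
open import Data.Bool using (Bool; true; false; _∧_; not; if_then_else_)
open import Data.List using (List; []; _∷_; map; concatMap; foldr; filter; length; allFin)
open import Data.Bool.ListAction using (and)
open import Relation.Nullary using (¬_; does)
open import Relation.Binary.PropositionalEquality using (_≡_)

record Field (c ℓ : Level) : Set (lsuc (c ⊔ ℓ)) where
  field
    commutativeRing : CommutativeRing c ℓ
  open CommutativeRing commutativeRing public
  field
    _⁻¹     : Carrier → Carrier
    0≉1     : ¬ (0# ≈ 1#)
    inverse : ∀ x → ¬ (x ≈ 0#) → x * (x ⁻¹) ≈ 1#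

_!! : ℕ → ℕ
zero !! = 1
suc zero !! = 1
suc (suc m) !! = suc (suc m) ℕ.* (m !!)

cons : ∀ {m k} → Fin k → (Fin m → Fin k) → (Fin (suc m) → Fin k)
cons i f Fin.zero = i
cons i f (Fin.suc j) = f j

allFuns : (m k : ℕ) → List (Fin m → Fin k)
allFuns zero k = (λ ()) ∷ []
allFuns (suc m) k = concatMap (λ f → map (λ i → cons i f) (allFin k)) (allFuns m k)

_<ᵇF_ : ∀ {m} → Fin m → Fin m → Bool
i <ᵇF j = toℕ i ℕ.<ᵇ toℕ j

-- σ : Fin m → Fin m is a permutation iff it is injective
isPerm : ∀ {m} → (Fin m → Fin m) → Bool
isPerm {m} σ = and (concatMap (λ i → map (λ j → not (i <ᵇF j) ∨' not (does (σ i ≟ σ j))) (allFin m)) (allFin m))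
  where
  _∨'_ : Bool → Bool → Bool
  true ∨' b = true
  false ∨' b = b

fixedPointFree : ∀ {m} → (Fin m → Fin m) → Bool
fixedPointFree {m} σ = and (map (λ i → not (does (σ i ≟ i))) (allFin m))

inversions : ∀ {m} → (Fin m → Fin m) → ℕ
inversions {m} σ = count (concatMap (λ i → map (λ j → (i <ᵇF j) ∧ (σ j <ᵇF σ i)) (allFin m)) (allFin m))
  where
  count : List Bool → ℕ
  count [] = 0
  count (true ∷ bs) = suc (count bs)
  count (false ∷ bs) = count bs

isEven : ℕ → Bool
isEven zero = true
isEven (suc m) = not (isEven m)

module FieldOps {c ℓ : Level} (F : Field c ℓ) where
  open Field F

  ι : ℕ → Carrier
  ι zero = 0#
  ι (suc m) = 1# + ι m

  _^_ : Carrier → ℕ → Carrier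
  x ^ zero = 1#
  x ^ suc m = x * (x ^ m)

  CharZero : Set ℓ
  CharZero = ∀ m → ι m ≈ 0# → m ≡ 0

  PrimitiveRoot : ℕ → Carrier → Set ℓ
  PrimitiveRoot n ζ = (ζ ^ n ≈ 1#) × (∀ d → 0 ℕ.< d → d ℕ.< n → ¬ (ζ ^ d ≈ 1#))
    where open import Data.Product using (_×_)

  sign : ∀ {m} → (Fin m → Fin m) → Carrier
  sign σ = if isEven (inversions σ) then 1# else - 1#

  sumList : List Carrier → Carrier
  sumList = foldr _+_ 0#

  prodFin : (m : ℕ) → (Fin m → Carrier) → Carrier
  prodFin zero f = 1#
  prodFin (suc m) f = f Fin.zero * prodFin m (λ i → f (Fin.suc i))

  det : (m : ℕ) → (Fin m → Fin m → Carrier) → Carrier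
  det m M = sumList (map (λ σ → sign σ * prodFin m (λ j → M j (σ j)))
                         (filter (λ σ → Data.Bool._≟_ (isPerm σ) true) (allFuns m m)))

  derangementSum : (m : ℕ) → (Fin m → Fin m → Carrier) → Carrier
  derangementSum m M = sumList (map (λ σ → sign σ * prodFin m (λ j → M j (σ j)))
                         (filter (λ σ → Data.Bool._≟_ (isPerm σ ∧ fixedPointFree σ) true) (allFuns m m)))

  -- ζ^(j - k) for naturals j, k (integer exponent, via ζ⁻¹ for negative)
  powDiff : Carrier → ℕ → ℕ → Carrier
  powDiff ζ j k = (ζ ^ (j ℕ.∸ k)) * ((ζ ⁻¹) ^ (k ℕ.∸ j))

  -- a_{jk} = (1 + ζ^{j-k}) / (1 - ζ^{j-k}) for j ≠ k, and 0 for j = k.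
  -- Index i : Fin (n-1) stands for j = i + 1; differences are unchanged.
  a : ∀ {m} → Carrier → Fin m → Fin m → Carrier
  a ζ j k = if does (j ≟ k) then 0#
            else (1# + powDiff ζ (toℕ j) (toℕ k)) * ((1# - powDiff ζ (toℕ j) (toℕ k)) ⁻¹)

  rhs : ℕ → Carrier
  rhs n = ((- 1#) ^ ((n ℕ.∸ 1) ℕ./ 2)) * ((ι ((n ℕ.∸ 2) !!) ^ 2) * (ι n ⁻¹))

{-# OPTIONS --safe #-}

-- With m = n − 1, V j r = ζ^(jr), W r k = ζ^(−rk) and λ_r = n − 2r for 1 ≤ j, k, r ≤ m, summation by
-- parts gives Σ_r λ_r z^r = n (1 + z) / (1 − z) for every n-th root of unity z ≠ 1.  As the
-- rows of V and the columns of W sum to −1, it follows that [x + a_jk] = V (diag (λ/n) + x J) W, where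
-- J is the all-ones matrix.
-- Now det (diag d + x J) = ∏ d · (1 + x Σ 1/d), and Σ 1/λ = 0 because λ_(n−r) = −λ_r, so the
-- middle factor has determinant ∏ λ / n^m for all x.  Finally V W = n I − J has determinant
-- n^m / n by the same formula, which leaves ∏ λ / n.
module Submission where

open import Defs
open import Level using (Level)
open import Algebra.Bundles using (CommutativeMonoid)
open import Data.Bool as Bool using (Bool; true; false; if_then_else_; not; _∧_; _∨_)
open import Data.Bool.ListAction using (and)
open import Data.Empty using (⊥-elim)
open import Data.Fin as Fin using (Fin; zero; suc; toℕ; inject₁)
open import Data.Fin.Permutation using (reverse)
import Data.Fin.Properties as Fin
open import Data.List using (List; []; _∷_; _++_; map; concatMap; foldr; filter; allFin; tabulate)
open import Data.List.Properties using (map-cong; concatMap-cong)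
open import Data.Nat as ℕ using (ℕ; zero; suc; _<_; _∸_; _%_)
import Data.Nat.DivMod as ℕ
import Data.Nat.Properties as ℕ
open import Data.Product using (_×_; _,_; proj₁; proj₂; ∃)
open import Data.Sum using (_⊎_; inj₁; inj₂)
open import Function using (_∘_; id)
open import Relation.Binary.Definitions using (tri<; tri≈; tri>)
open import Relation.Binary.PropositionalEquality as ≡ using (_≡_; _≗_)
open import Relation.Nullary using (¬_; yes; no; does)

-- `det` is a list sum over filtered functions, signed by counting inversions, so its
-- multiplicativity has to come from that definition. The filter is absorbed into a weight, `levi`,
-- which vanishes off the permutations. Sums then run over all functions, and a product of row sums
-- expands without any bookkeeping of injectivity. Functions agree only pointwise, hence the
-- extensionality arguments.
--
-- Since the size is n - 1, V and W are a Fourier matrix and its inverse transform with the trivial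
-- index dropped. This is why V W is n I - J rather than n I, and also why V J W = J: each side of J
-- contributes a factor -1, so the shift by x keeps its shape on the eigenvalue side.
--
-- Oddness of n and characteristic zero together make every λ_r nonzero. Characteristic zero also
-- gives n ≠ 0 and 2 ≠ 0, the latter behind each passage from x = -x to x = 0. The λ_r are ±1, ±3,
-- ..., ±(n - 2): the (n - 1)/2 negative ones give the sign, and the equal absolute values give the
-- squared double factorial.

countTrue : List Bool → ℕ
countTrue [] = 0
countTrue (true ∷ bs) = suc (countTrue bs)
countTrue (false ∷ bs) = countTrue bs

pairs : ∀ {A : Set} m → (Fin m → Fin m → A) → List A
pairs m f = concatMap (λ i → map (f i) (allFin m)) (allFin m)

-- The operations local to inversions and isPerm cannot be named here: the left-hand sides _ below
-- are inferred to be these operations from the calls made in the same mutual block.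
mutual
  inversions≡countTrue : ∀ {m} (σ : Fin m → Fin m) →
    inversions σ ≡ countTrue (pairs m λ i j → (i <ᵇF j) ∧ (σ j <ᵇF σ i))
  inversions≡countTrue {m} σ with pairs m (λ i j → (i <ᵇF j) ∧ (σ j <ᵇF σ i))
  ... | bs = count≡countTrue σ bs

  count≡countTrue : ∀ {m} (σ : Fin m → Fin m) (bs : List Bool) → _ ≡ countTrue bs
  count≡countTrue σ [] = ≡.refl
  count≡countTrue σ (true ∷ bs) = ≡.cong suc (count≡countTrue σ bs)
  count≡countTrue σ (false ∷ bs) = count≡countTrue σ bs

mutual
  isPerm≡and : ∀ {m} (σ : Fin m → Fin m) →
    isPerm σ ≡ and (pairs m λ i j → not (i <ᵇF j) ∨ not (does (σ i Fin.≟ σ j)))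
  isPerm≡and {m} σ =
    ≡.cong and (concatMap-cong (λ i → map-cong (separated σ i) (allFin m)) (allFin m))

  separated : ∀ {m} (σ : Fin m → Fin m) (i j : Fin m) →
    _ ≡ not (i <ᵇF j) ∨ not (does (σ i Fin.≟ σ j))
  separated σ i j with not (i <ᵇF j) | not (does (σ i Fin.≟ σ j))
  ... | b | c = or≡∨ σ i j b c

  or≡∨ : ∀ {m} (σ : Fin m → Fin m) (i j : Fin m) (b c : Bool) → _ ≡ b ∨ c
  or≡∨ σ i j true c = ≡.refl
  or≡∨ σ i j false c = ≡.refl

fixedPointFree-false : ∀ {m} (σ : Fin m → Fin m) → fixedPointFree σ ≡ false → ∃ λ i → σ i ≡ i
fixedPointFree-false {m} σ = go id
  where
  -- `allFin m` is `tabulate id`; the induction needs an arbitrary `f` in place of `id`.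
  go : ∀ {k} (f : Fin k → Fin m) →
       and (map (λ i → not (does (σ i Fin.≟ i))) (tabulate f)) ≡ false → ∃ λ i → σ i ≡ i
  go {suc k} f eq with σ (f zero) Fin.≟ f zero
  ... | yes p = f zero , p
  ... | no _ = go (f ∘ suc) eq

-- Folds over lists and sums over finite index sets in a commutative monoid

module FoldList {c ℓ} (M : CommutativeMonoid c ℓ) where
  open CommutativeMonoid M
  open import Algebra.Properties.CommutativeMonoid.Sum M using (sum; sum-cong-≋)
  open import Relation.Binary.Reasoning.Setoid setoid

  fold : List Carrier → Carrier
  fold = foldr _∙_ ε

  fold-map-++ : ∀ {a} {A : Set a} (h : A → Carrier) xs ys →
    fold (map h (xs ++ ys)) ≈ fold (map h xs) ∙ fold (map h ys)
  fold-map-++ h [] ys = sym (identityˡ _)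
  fold-map-++ h (x ∷ xs) ys = trans (∙-congˡ (fold-map-++ h xs ys)) (sym (assoc _ _ _))

  fold-map-cong : ∀ {a} {A : Set a} {g h : A → Carrier} → (∀ x → g x ≈ h x) → ∀ xs →
    fold (map g xs) ≈ fold (map h xs)
  fold-map-cong e [] = refl
  fold-map-cong e (x ∷ xs) = ∙-cong (e x) (fold-map-cong e xs)

  fold-concatMap : ∀ {a b} {A : Set a} {B : Set b} (h : B → Carrier) (f : A → List B) xs →
    fold (map h (concatMap f xs)) ≈ fold (map (λ x → fold (map h (f x))) xs)
  fold-concatMap h f [] = refl
  fold-concatMap h f (x ∷ xs) =
    trans (fold-map-++ h (f x) (concatMap f xs)) (∙-congˡ (fold-concatMap h f xs))

  fold-tabulate : ∀ {a} {A : Set a} {m} (h : A → Carrier) (f : Fin m → A) →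
    fold (map h (tabulate f)) ≈ sum (h ∘ f)
  fold-tabulate {m = zero} h f = refl
  fold-tabulate {m = suc m} h f = ∙-congˡ (fold-tabulate h (f ∘ suc))

  fold-map-tabulate : ∀ {a b} {A : Set a} {B : Set b} {m} (h : B → Carrier) (g : A → B) (f : Fin m → A) →
    fold (map h (map g (tabulate f))) ≈ sum (h ∘ g ∘ f)
  fold-map-tabulate {m = zero} h g f = refl
  fold-map-tabulate {m = suc m} h g f = ∙-congˡ (fold-map-tabulate h g (f ∘ suc))

  fold-pairs : ∀ {A : Set} m (h : A → Carrier) (f : Fin m → Fin m → A) →
    fold (map h (pairs m f)) ≈ sum (λ i → sum (λ j → h (f i j)))
  fold-pairs m h f = begin
    fold (map h (pairs m f))                                  ≈⟨ fold-concatMap h _ (allFin m) ⟩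
    fold (map (λ i → fold (map h (map (f i) (allFin m)))) (allFin m))
      ≈⟨ fold-tabulate {m = m} _ id ⟩
    sum (λ i → fold (map h (map (f i) (allFin m))))           ≈⟨ sum-cong-≋ (λ i → fold-map-tabulate h (f i) id) ⟩
    sum (λ i → sum (λ j → h (f i j)))                         ∎

  fold-allFuns : ∀ m {k} (g : (Fin (suc m) → Fin k) → Carrier) →
    fold (map g (allFuns (suc m) k)) ≈ fold (map (λ f → sum (λ i → g (cons i f))) (allFuns m k))
  fold-allFuns m {k} g = trans (fold-concatMap g _ (allFuns m k))
    (fold-map-cong (λ f → fold-map-tabulate g (λ i → cons i f) id) (allFuns m k))

-- Adjacent transpositions and insertion sort of functions

swap : ∀ {m} → Fin m → Fin (suc m) → Fin (suc m)
swap zero zero = suc zero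
swap zero (suc zero) = zero
swap zero (suc (suc j)) = suc (suc j)
swap (suc i) zero = zero
swap (suc i) (suc j) = suc (swap i j)

-- Meant for quantities that change sign under `swap i`: at a function with two equal neighbouring
-- values they equal their own negative.
swap-fixes : ∀ {a} {A : Set a} {m} (σ : Fin (suc m) → A) i →
  σ (inject₁ i) ≡ σ (suc i) → σ ∘ swap i ≗ σ
swap-fixes σ zero eq zero = ≡.sym eq
swap-fixes σ zero eq (suc zero) = eq
swap-fixes σ zero eq (suc (suc j)) = ≡.refl
swap-fixes σ (suc i) eq zero = ≡.refl
swap-fixes σ (suc i) eq (suc j) = swap-fixes (σ ∘ suc) i eq j

cons-cong : ∀ {m k} (a : Fin k) {σ τ : Fin m → Fin k} → σ ≗ τ → cons a σ ≗ cons a τ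
cons-cong a e zero = ≡.refl
cons-cong a e (suc j) = e j

cons-head-tail : ∀ {m k} (σ : Fin (suc m) → Fin k) → cons (σ zero) (σ ∘ suc) ≗ σ
cons-head-tail σ zero = ≡.refl
cons-head-tail σ (suc j) = ≡.refl

cons-swap : ∀ {m k} (a : Fin k) (σ : Fin (suc m) → Fin k) i →
  cons a (σ ∘ swap i) ≗ cons a σ ∘ swap (suc i)
cons-swap a σ i zero = ≡.refl
cons-swap a σ i (suc j) = ≡.refl

cons-cons-swap : ∀ {m k} (a b : Fin k) (σ : Fin m → Fin k) →
  cons b (cons a σ) ≗ cons a (cons b σ) ∘ swap zero
cons-cons-swap a b σ zero = ≡.refl
cons-cons-swap a b σ (suc zero) = ≡.refl
cons-cons-swap a b σ (suc (suc j)) = ≡.refl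

cons-suc : ∀ {m k} (a : Fin k) (σ : Fin m → Fin k) → cons (suc a) (suc ∘ σ) ≗ suc ∘ cons a σ
cons-suc a σ zero = ≡.refl
cons-suc a σ (suc j) = ≡.refl

Monotone : ∀ {m k} → (Fin m → Fin k) → Set
Monotone σ = ∀ i j → i Fin.≤ j → σ i Fin.≤ σ j

cons-monotone : ∀ {m k} (a : Fin k) (σ : Fin m → Fin k) → Monotone σ →
  (∀ j → a Fin.≤ σ j) → Monotone (cons a σ)
cons-monotone a σ mono a≤ zero zero _ = ℕ.≤-refl
cons-monotone a σ mono a≤ zero (suc j) _ = a≤ j
cons-monotone a σ mono a≤ (suc i) (suc j) (ℕ.s≤s i≤j) = mono i j i≤j

-- The inner loop of insertion sort as an induction principle: `a` moves right past smaller values.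
-- The bound `b` remembers the entry last left behind, so that putting it back in front of a sorted
-- tail keeps the whole monotone.
insertion : ∀ {p} m {k} (P : (Fin (suc m) → Fin k) → Set p) →
  (∀ {σ τ} → σ ≗ τ → P σ → P τ) → (∀ i σ → P (σ ∘ swap i) → P σ) →
  ∀ b → (∀ τ → Monotone τ → (∀ j → b ℕ.≤ toℕ (τ j)) → P τ) →
  ∀ a σ → b ℕ.≤ toℕ a → Monotone σ → (∀ j → b ℕ.≤ toℕ (σ j)) → P (cons a σ)
insertion zero P resp unswap b base a σ b≤a mono b≤σ =
  base (cons a σ) (cons-monotone a σ mono λ ()) λ { zero → b≤a }
insertion (suc m) P resp unswap b base a σ b≤a mono b≤σ with a Fin.≤? σ zero
... | yes a≤σ₀ = base (cons a σ)
  (cons-monotone a σ mono λ j → ℕ.≤-trans a≤σ₀ (mono zero j ℕ.z≤n))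
  λ { zero → b≤a ; (suc j) → b≤σ j }
... | no a≰σ₀ = unswap zero (cons a σ) (resp swapped
  (insertion m (P ∘ cons (σ zero))
    (λ e → resp (cons-cong (σ zero) e))
    (λ i τ → unswap (suc i) (cons (σ zero) τ) ∘ resp (cons-swap (σ zero) τ i))
    (toℕ (σ zero))
    (λ τ τ-mono σ₀≤τ → base (cons (σ zero) τ) (cons-monotone (σ zero) τ τ-mono σ₀≤τ)
      λ { zero → b≤σ zero ; (suc j) → ℕ.≤-trans (b≤σ zero) (σ₀≤τ j) })
    a (σ ∘ suc) (ℕ.≰⇒≥ a≰σ₀) (λ i j i≤j → mono (suc i) (suc j) (ℕ.s≤s i≤j))
    (λ j → mono zero (suc j) ℕ.z≤n)))
  where
  swapped : cons (σ zero) (cons a (σ ∘ suc)) ≗ cons a σ ∘ swap zero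
  swapped zero = ≡.refl
  swapped (suc zero) = ≡.refl
  swapped (suc (suc j)) = ≡.refl

-- Insertion sort: the tail is sorted with the head kept in front, then `insertion` places the head.
-- Claims that behave predictably under adjacent swaps are thereby reduced to monotone functions.
sorting : ∀ {p} m {k} (P : (Fin (suc m) → Fin k) → Set p) →
  (∀ {σ τ} → σ ≗ τ → P σ → P τ) → (∀ i σ → P (σ ∘ swap i) → P σ) →
  (∀ τ → Monotone τ → P τ) → ∀ σ → P σ
sorting zero P resp unswap base σ = base σ λ { zero zero _ → ℕ.≤-refl }
sorting (suc m) P resp unswap base σ = resp (cons-head-tail σ)
  (sorting m (P ∘ cons (σ zero))
    (λ e → resp (cons-cong (σ zero) e))
    (λ i τ → unswap (suc i) (cons (σ zero) τ) ∘ resp (cons-swap (σ zero) τ i))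
    (λ τ mono → insertion (suc m) P resp unswap 0 (λ ρ ρ-mono _ → base ρ ρ-mono)
      (σ zero) τ ℕ.z≤n mono λ _ → ℕ.z≤n)
    (σ ∘ suc))

-- There is no slack: m + 1 strictly increasing values lie among the m + 1 numbers from `b` on.
strict⇒shift : ∀ m (f : Fin (suc m) → ℕ) b → (∀ i → f (inject₁ i) < f (suc i)) →
  b ℕ.≤ f zero → (∀ j → f j < b ℕ.+ suc m) → ∀ j → f j ≡ b ℕ.+ toℕ j
strict⇒shift zero f b strict b≤ f< zero = ℕ.≤-antisym
  (ℕ.≤-pred (≡.subst (f zero <_) (ℕ.+-suc b 0) (f< zero)))
  (≡.subst (ℕ._≤ f zero) (≡.sym (ℕ.+-identityʳ b)) b≤)
strict⇒shift (suc m) f b strict b≤ f< = λ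
  { zero → ℕ.≤-antisym
      (ℕ.≤-pred (≡.subst (f zero <_) (tail zero) (strict zero)))
      (≡.subst (ℕ._≤ f zero) (≡.sym (ℕ.+-identityʳ b)) b≤)
  ; (suc j) → ≡.trans (tail j) (≡.sym (ℕ.+-suc b (toℕ j))) }
  where
  tail : ∀ j → f (suc j) ≡ suc b ℕ.+ toℕ j
  tail = strict⇒shift m (f ∘ suc) (suc b) (strict ∘ suc)
    (ℕ.≤-<-trans b≤ (strict zero)) (λ j → ≡.subst (f (suc j) <_) (ℕ.+-suc b (suc m)) (f< (suc j)))

-- With no two neighbouring values equal, `σ` increases strictly, which leaves it no room to differ
-- from the identity.
monotone⇒id⊎repeats : ∀ {m} (σ : Fin (suc m) → Fin (suc m)) → Monotone σ →
  (∀ j → σ j ≡ j) ⊎ (∃ λ i → σ (inject₁ i) ≡ σ (suc i))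
monotone⇒id⊎repeats {m} σ mono with Fin.any? (λ i → σ (inject₁ i) Fin.≟ σ (suc i))
... | yes repeats = inj₂ repeats
... | no distinct = inj₁ λ j → Fin.toℕ-injective
  (strict⇒shift m (toℕ ∘ σ) 0
    (λ i → ℕ.≤∧≢⇒< (mono (inject₁ i) (suc i) (ℕ.≤-trans (ℕ.≤-reflexive (Fin.toℕ-inject₁ i)) (ℕ.n≤1+n _)))
      λ eq → distinct (i , Fin.toℕ-injective eq))
    ℕ.z≤n (λ j → Fin.toℕ<n (σ j)) j)

-- Determinants over a field of characteristic zero, and the Levi-Civita symbol

module Determinants {c ℓ : Level} (F : Field c ℓ) (charZero : FieldOps.CharZero F) where
  open Field F hiding (zero)
  open FieldOps F hiding (a)
  open import Algebra.Properties.Ring ring public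
    using (-‿distribˡ-*; -‿distribʳ-*; -‿involutive; -1*x≈-x; -0#≈0#)
  open import Algebra.Properties.Semiring.Sum semiring public
  open import Algebra.Properties.CommutativeMonoid.Sum *-commutativeMonoid public
    using () renaming (sum to ∏; sum-cong-≋ to ∏-cong; ∑-distrib-+ to ∏-distrib;
                       sum-init-last to ∏-init-last; sum-replicate-zero to ∏-ones)
  open import Relation.Binary.Reasoning.Setoid setoid
  open import Algebra.Solver.Ring.NaturalCoefficients.Default commutativeSemiring
    using (solve; _:+_; _:*_; _:=_; con)
  open FoldList +-commutativeMonoid
  open FoldList *-commutativeMonoid using () renaming (fold to product; fold-pairs to product-pairs)

  prodFin≈∏ : ∀ m (f : Fin m → Carrier) → prodFin m f ≈ ∏ f
  prodFin≈∏ zero f = refl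
  prodFin≈∏ (suc m) f = *-congˡ (prodFin≈∏ m (f ∘ suc))

  ∏-zero : ∀ {m} (f : Fin m → Carrier) i → f i ≈ 0# → ∏ f ≈ 0#
  ∏-zero f zero e = trans (*-congʳ e) (zeroˡ _)
  ∏-zero f (suc i) e = trans (*-congˡ (∏-zero (f ∘ suc) i e)) (zeroʳ _)

  sum-zero : ∀ {m} (f : Fin m → Carrier) → (∀ i → f i ≈ 0#) → sum f ≈ 0#
  sum-zero {m} f e = trans (sum-cong-≋ e) (sum-replicate-zero m)

  ∏-swap : ∀ {m} (f : Fin (suc m) → Carrier) i → ∏ (f ∘ swap i) ≈ ∏ f
  ∏-swap f zero = solve 3 (λ a b c → a :* (b :* c) := b :* (a :* c)) refl (f (suc zero)) (f zero) _
  ∏-swap f (suc i) = *-congˡ (∏-swap (f ∘ suc) i)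

  -- The sign of b - a. A product of such signs over pairs of positions vanishes at a repeated value
  -- and otherwise gives the parity of the inversions.
  orient : ∀ {k} → Fin k → Fin k → Carrier
  orient zero zero = 0#
  orient zero (suc b) = 1#
  orient (suc a) zero = - 1#
  orient (suc a) (suc b) = orient a b

  orient-refl : ∀ {k} (a : Fin k) → orient a a ≈ 0#
  orient-refl zero = refl
  orient-refl (suc a) = orient-refl a

  orient-anti : ∀ {k} (a b : Fin k) → orient b a ≈ - orient a b
  orient-anti zero zero = sym -0#≈0#
  orient-anti zero (suc b) = refl
  orient-anti (suc a) zero = sym (-‿involutive 1#)
  orient-anti (suc a) (suc b) = orient-anti a b

  -- The Levi-Civita symbol: the sign of σ, and 0# if σ is not injective.
  levi : ∀ {m k} → (Fin m → Fin k) → Carrier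
  levi {zero} σ = 1#
  levi {suc m} σ = ∏ (λ j → orient (σ zero) (σ (suc j))) * levi (σ ∘ suc)

  levi-cong : ∀ {m k} {σ τ : Fin m → Fin k} → σ ≗ τ → levi σ ≈ levi τ
  levi-cong {zero} e = refl
  levi-cong {suc m} e = *-cong
    (∏-cong λ j → reflexive (≡.cong₂ orient (e zero) (e (suc j)))) (levi-cong (e ∘ suc))

  -- Among all pairs of positions, an adjacent swap reverses exactly one and permutes the others.
  levi-swap : ∀ {m k} (σ : Fin (suc m) → Fin k) i → levi (σ ∘ swap i) ≈ - levi σ
  levi-swap {suc m} σ zero = begin
    (orient b a * p) * (q * r)   ≈⟨ *-congʳ (*-congʳ (orient-anti a b)) ⟩
    (- orient a b * p) * (q * r) ≈⟨ solve 4 (λ o p q r → (o :* p) :* (q :* r) := o :* (q :* (p :* r)))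
                                      refl (- orient a b) p q r ⟩
    - orient a b * (q * (p * r)) ≈⟨ -‿distribˡ-* _ _ ⟨
    - (orient a b * (q * (p * r))) ≈⟨ -‿cong (*-assoc _ _ _) ⟨
    - ((orient a b * q) * (p * r)) ∎
    where
    a = σ zero
    b = σ (suc zero)
    p = ∏ (λ j → orient b (σ (suc (suc j))))
    q = ∏ (λ j → orient a (σ (suc (suc j))))
    r = levi (λ j → σ (suc (suc j)))
  levi-swap {suc m} σ (suc i) = begin
    ∏ (λ j → orient (σ zero) (σ (suc (swap i j)))) * levi (σ ∘ suc ∘ swap i)
      ≈⟨ *-cong (∏-swap (λ j → orient (σ zero) (σ (suc j))) i) (levi-swap (σ ∘ suc) i) ⟩
    ∏ (λ j → orient (σ zero) (σ (suc j))) * - levi (σ ∘ suc)    ≈⟨ -‿distribʳ-* _ _ ⟨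
    - levi σ ∎

  levi-repeat : ∀ {m k} (σ : Fin m → Fin k) i j → i Fin.< j → σ i ≡ σ j → levi σ ≈ 0#
  levi-repeat σ zero (suc j) _ eq = trans (*-congʳ (∏-zero _ j
    (trans (reflexive (≡.cong (orient (σ zero)) (≡.sym eq))) (orient-refl (σ zero))))) (zeroˡ _)
  levi-repeat σ (suc i) (suc j) (ℕ.s≤s i<j) eq =
    trans (*-congˡ (levi-repeat (σ ∘ suc) i j i<j eq)) (zeroʳ _)

  levi-id : ∀ m → levi {m} id ≈ 1#
  levi-id m = go {m} id (λ i<j → i<j)
    where
    orient-< : ∀ {k} {a b : Fin k} → a Fin.< b → orient a b ≈ 1#
    orient-< {a = zero} {suc b} _ = refl
    orient-< {a = suc a} {suc b} (ℕ.s≤s a<b) = orient-< a<b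
    go : ∀ {m k} (σ : Fin m → Fin k) → (∀ {i j} → i Fin.< j → σ i Fin.< σ j) → levi σ ≈ 1#
    go {zero} σ mono = refl
    go {suc m} σ mono = trans (*-cong (trans (∏-cong {m} λ j → orient-< (mono {zero} {suc j} ℕ.z<s)) (∏-ones m))
      (go (σ ∘ suc) (mono ∘ ℕ.s≤s))) (*-identityˡ 1#)

  -- Permutation test and inversion sign expressed by the Levi-Civita symbol

  indicator : Bool → Carrier
  indicator b = if b then 1# else 0#

  parity : Bool → Carrier
  parity b = if b then - 1# else 1#

  indicator-and : ∀ bs → indicator (and bs) ≈ product (map indicator bs)
  indicator-and [] = refl
  indicator-and (true ∷ bs) = trans (indicator-and bs) (sym (*-identityˡ _))
  indicator-and (false ∷ bs) = sym (zeroˡ _)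

  parity-countTrue : ∀ bs → (if isEven (countTrue bs) then 1# else - 1#) ≈ product (map parity bs)
  parity-countTrue [] = refl
  parity-countTrue (false ∷ bs) = trans (parity-countTrue bs) (sym (*-identityˡ _))
  parity-countTrue (true ∷ bs) = begin
    (if not (isEven n) then 1# else - 1#)   ≈⟨ negated (isEven n) ⟩
    - (if isEven n then 1# else - 1#)       ≈⟨ -‿cong (parity-countTrue bs) ⟩
    - product (map parity bs)               ≈⟨ -1*x≈-x _ ⟨
    - 1# * product (map parity bs)          ∎
    where
    n = countTrue bs
    negated : ∀ b → (if not b then 1# else - 1#) ≈ - (if b then 1# else - 1#)
    negated true = refl
    negated false = sym (-‿involutive 1#)

  upperTriangle : ∀ {m} → (Fin m → Fin m → Carrier) → Carrier
  upperTriangle t = ∏ λ i → ∏ λ j → if i <ᵇF j then t i j else 1#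

  levi≈upperTriangle : ∀ {m k} (σ : Fin m → Fin k) →
    upperTriangle (λ i j → orient (σ i) (σ j)) ≈ levi σ
  levi≈upperTriangle {zero} σ = refl
  levi≈upperTriangle {suc m} σ = *-cong (*-identityˡ _)
    (trans (∏-cong {m} λ i → *-identityˡ _) (levi≈upperTriangle (σ ∘ suc)))

  orient≈parity : ∀ {k} (a b : Fin k) →
    indicator (not (does (a Fin.≟ b))) * parity (b <ᵇF a) ≈ orient a b
  orient≈parity zero zero = zeroˡ _
  orient≈parity zero (suc b) = *-identityˡ _
  orient≈parity (suc a) zero = *-identityˡ _
  orient≈parity (suc a) (suc b) = orient≈parity a b

  -- Injectivity and inversion parity are both products over pairs i < j, and at each single pair
  -- the two factors multiply to `orient` of the values.
  isPerm-sign≈levi : ∀ {m} (σ : Fin m → Fin m) → indicator (isPerm σ) * sign σ ≈ levi σ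
  isPerm-sign≈levi {m} σ = begin
    indicator (isPerm σ) * sign σ
      ≡⟨ ≡.cong₂ (λ b n → indicator b * (if isEven n then 1# else - 1#))
           (isPerm≡and σ) (inversions≡countTrue σ) ⟩
    indicator (and (pairs m distinct)) * (if isEven (countTrue (pairs m inverted)) then 1# else - 1#)
      ≈⟨ *-cong (indicator-and (pairs m distinct)) (parity-countTrue (pairs m inverted)) ⟩
    product (map indicator (pairs m distinct)) * product (map parity (pairs m inverted))
      ≈⟨ *-cong (product-pairs m indicator distinct) (product-pairs m parity inverted) ⟩
    ∏ (λ i → ∏ (λ j → indicator (distinct i j))) * ∏ (λ i → ∏ (λ j → parity (inverted i j)))
      ≈⟨ ∏-distrib {m} _ _ ⟨
    ∏ (λ i → ∏ (λ j → indicator (distinct i j)) * ∏ (λ j → parity (inverted i j)))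
      ≈⟨ ∏-cong {m} (λ i → trans (sym (∏-distrib {m} _ _)) (∏-cong {m} (factor i))) ⟩
    upperTriangle (λ i j → orient (σ i) (σ j))
      ≈⟨ levi≈upperTriangle σ ⟩
    levi σ ∎
    where
    distinct inverted : Fin m → Fin m → Bool
    distinct i j = not (i <ᵇF j) ∨ not (does (σ i Fin.≟ σ j))
    inverted i j = (i <ᵇF j) ∧ (σ j <ᵇF σ i)
    factor : ∀ i j → indicator (distinct i j) * parity (inverted i j)
                     ≈ (if i <ᵇF j then orient (σ i) (σ j) else 1#)
    factor i j with i <ᵇF j
    ... | true = orient≈parity (σ i) (σ j)
    ... | false = *-identityˡ _

  -- Sums over all functions between finite sets

  fold-filter : ∀ {a} {A : Set a} (p : A → Bool) (h : A → Carrier) xs →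
    fold (map h (filter (λ x → p x Bool.≟ true) xs)) ≈ fold (map (λ x → indicator (p x) * h x) xs)
  fold-filter p h [] = refl
  fold-filter p h (x ∷ xs) with p x
  ... | true = +-cong (sym (*-identityˡ _)) (fold-filter p h xs)
  ... | false = trans (fold-filter p h xs) (sym (trans (+-congʳ (zeroˡ _)) (+-identityˡ _)))

  fold-*ˡ : ∀ {a} {A : Set a} x (h : A → Carrier) ys → x * fold (map h ys) ≈ fold (map (λ y → x * h y) ys)
  fold-*ˡ x h [] = zeroʳ x
  fold-*ˡ x h (y ∷ ys) = trans (distribˡ _ _ _) (+-congˡ (fold-*ˡ x h ys))

  fold-+ : ∀ {a} {A : Set a} (g h : A → Carrier) xs →
    fold (map (λ x → g x + h x) xs) ≈ fold (map g xs) + fold (map h xs)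
  fold-+ g h [] = sym (+-identityˡ _)
  fold-+ g h (x ∷ xs) = trans (+-congˡ (fold-+ g h xs))
    (solve 4 (λ a b c d → (a :+ b) :+ (c :+ d) := (a :+ c) :+ (b :+ d)) refl _ _ _ _)

  fold-zero : ∀ {a} {A : Set a} (h : A → Carrier) → (∀ x → h x ≈ 0#) → ∀ xs → fold (map h xs) ≈ 0#
  fold-zero h e [] = refl
  fold-zero h e (x ∷ xs) = trans (+-cong (e x) (fold-zero h e xs)) (+-identityˡ _)

  fold-comm : ∀ {a b} {A : Set a} {B : Set b} (g : A → B → Carrier) xs ys →
    fold (map (λ x → fold (map (g x) ys)) xs) ≈ fold (map (λ y → fold (map (λ x → g x y) xs)) ys)
  fold-comm g [] ys = sym (fold-zero _ (λ _ → refl) ys)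
  fold-comm g (x ∷ xs) ys = trans (+-congˡ (fold-comm g xs ys)) (sym (fold-+ (g x) _ ys))

  ∑ᶠ : ∀ {m k} → ((Fin m → Fin k) → Carrier) → Carrier
  ∑ᶠ {m} {k} g = fold (map g (allFuns m k))

  Extensional : ∀ {m k} → ((Fin m → Fin k) → Carrier) → Set ℓ
  Extensional g = ∀ {σ τ} → σ ≗ τ → g σ ≈ g τ

  ∑ᶠ-cong : ∀ {m k} {g h : (Fin m → Fin k) → Carrier} → (∀ σ → g σ ≈ h σ) → ∑ᶠ g ≈ ∑ᶠ h
  ∑ᶠ-cong {m} {k} e = fold-map-cong e (allFuns m k)

  -- Precomposition with a swap only permutes the functions. For the first two arguments this is an
  -- exchange of two summations; later positions are reached by peeling off the first value.
  ∑ᶠ-swap : ∀ {m k} (g : (Fin (suc m) → Fin k) → Carrier) → Extensional g → ∀ i →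
    ∑ᶠ (λ σ → g (σ ∘ swap i)) ≈ ∑ᶠ g
  ∑ᶠ-swap {suc m} {k} g ext zero = begin
    ∑ᶠ (λ σ → g (σ ∘ swap zero))
      ≈⟨ trans (fold-allFuns (suc m) _) (fold-allFuns m _) ⟩
    ∑ᶠ (λ f → sum (λ a → sum (λ b → g (cons b (cons a f) ∘ swap zero))))
      ≈⟨ ∑ᶠ-cong (λ f → sum-cong-≋ {k} λ a → sum-cong-≋ {k} λ b → ext (λ j → ≡.sym (cons-cons-swap b a f j))) ⟩
    ∑ᶠ (λ f → sum (λ a → sum (λ b → g (cons a (cons b f)))))
      ≈⟨ ∑ᶠ-cong (λ f → ∑-comm {k} {k} (λ a b → g (cons a (cons b f)))) ⟩
    ∑ᶠ (λ f → sum (λ b → sum (λ a → g (cons a (cons b f)))))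
      ≈⟨ trans (fold-allFuns (suc m) g) (fold-allFuns m _) ⟨
    ∑ᶠ g ∎
  ∑ᶠ-swap {suc m} {k} g ext (suc i) = begin
    ∑ᶠ (λ σ → g (σ ∘ swap (suc i)))                            ≈⟨ fold-allFuns (suc m) _ ⟩
    ∑ᶠ (λ f → sum (λ a → g (cons a f ∘ swap (suc i))))
      ≈⟨ ∑ᶠ-cong (λ f → sum-cong-≋ {k} λ a → ext (λ j → ≡.sym (cons-swap a f i j))) ⟩
    ∑ᶠ (λ f → sum (λ a → g (cons a (f ∘ swap i))))
      ≈⟨ ∑ᶠ-swap (λ f → sum (λ a → g (cons a f))) (λ e → sum-cong-≋ {k} λ a → ext (cons-cong a e)) i ⟩
    ∑ᶠ (λ f → sum (λ a → g (cons a f)))                        ≈⟨ fold-allFuns (suc m) g ⟨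
    ∑ᶠ g ∎

  -- Serves to shrink the codomain in row and column expansions: the surviving functions miss `zero`
  -- and so factor through `suc`.
  ∑ᶠ-avoiding-zero : ∀ {m k} (g : (Fin m → Fin (suc k)) → Carrier) → Extensional g →
    (∀ f j → f j ≡ zero → g f ≈ 0#) → ∑ᶠ g ≈ ∑ᶠ (λ (f : Fin m → Fin k) → g (suc ∘ f))
  ∑ᶠ-avoiding-zero {zero} g ext vanish = +-congʳ (ext λ ())
  ∑ᶠ-avoiding-zero {suc m} {k} g ext vanish = begin
    ∑ᶠ g                                                    ≈⟨ fold-allFuns m g ⟩
    ∑ᶠ (λ f → g (cons zero f) + sum (λ i → g (cons (suc i) f)))
      ≈⟨ ∑ᶠ-cong {m} {suc k} (λ f → trans (+-congʳ (vanish (cons zero f) zero ≡.refl)) (+-identityˡ _)) ⟩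
    ∑ᶠ (λ f → sum (λ i → g (cons (suc i) f)))
      ≈⟨ ∑ᶠ-avoiding-zero _ (λ e → sum-cong-≋ {k} λ i → ext (cons-cong (suc i) e))
           (λ f j eq → sum-zero {k} _ λ i → vanish _ (suc j) eq) ⟩
    ∑ᶠ (λ f → sum (λ i → g (cons (suc i) (suc ∘ f))))
      ≈⟨ ∑ᶠ-cong {m} {k} (λ f → sum-cong-≋ {k} λ i → ext (cons-suc i f)) ⟩
    ∑ᶠ (λ f → sum (λ i → g (suc ∘ cons i f)))                 ≈⟨ fold-allFuns m _ ⟨
    ∑ᶠ (λ f → g (suc ∘ f)) ∎

  ∏-sum : ∀ {m k} (T : Fin m → Fin k → Carrier) →
    ∏ (λ j → sum (T j)) ≈ ∑ᶠ (λ τ → ∏ (λ j → T j (τ j)))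
  ∏-sum {zero} T = sym (+-identityʳ _)
  ∏-sum {suc m} {k} T = begin
    sum (T zero) * ∏ (λ j → sum (T (suc j)))              ≈⟨ *-congˡ (∏-sum (T ∘ suc)) ⟩
    sum (T zero) * ∑ᶠ rest                                ≈⟨ fold-*ˡ _ rest (allFuns m k) ⟩
    ∑ᶠ (λ f → sum (T zero) * rest f)                      ≈⟨ ∑ᶠ-cong (λ f → *-distribʳ-sum (rest f) (T zero)) ⟩
    ∑ᶠ (λ f → sum (λ i → T zero i * rest f))              ≈⟨ fold-allFuns m _ ⟨
    ∑ᶠ (λ τ → ∏ (λ j → T j (τ j))) ∎
    where
    rest : (Fin m → Fin k) → Carrier
    rest f = ∏ (λ j → T (suc j) (f j))

  -- The Leibniz sum and its multiplicativity

  Matrix : ℕ → Set c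
  Matrix m = Fin m → Fin m → Carrier

  leibnizTerm : ∀ {m} → Matrix m → (Fin m → Fin m) → Carrier
  leibnizTerm M σ = levi σ * ∏ (λ j → M j (σ j))

  leibniz : ∀ {m} → Matrix m → Carrier
  leibniz M = ∑ᶠ (leibnizTerm M)

  leibnizTerm-ext : ∀ {m} (M : Matrix m) → Extensional (leibnizTerm M)
  leibnizTerm-ext {m} M e = *-cong (levi-cong e) (∏-cong {m} λ j → reflexive (≡.cong (M j) (e j)))

  leibniz-cong : ∀ {m} {M N : Matrix m} → (∀ i j → M i j ≈ N i j) → leibniz M ≈ leibniz N
  leibniz-cong {m} e = ∑ᶠ-cong λ σ → *-congˡ {levi σ} (∏-cong {m} λ j → e j (σ j))

  det≈leibniz : ∀ m (M : Matrix m) → det m M ≈ leibniz M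
  det≈leibniz m M = trans (fold-filter isPerm _ (allFuns m m)) (∑ᶠ-cong {m} {m} λ σ →
    trans (sym (*-assoc _ _ _)) (*-cong (isPerm-sign≈levi σ) (prodFin≈∏ m (λ j → M j (σ j)))))

  -- A permutation with a fixed point contributes a product that contains a diagonal entry, hence 0.
  derangementSum≈det : ∀ m (M : Matrix m) → (∀ i → M i i ≈ 0#) → derangementSum m M ≈ det m M
  derangementSum≈det m M diagonal = begin
    derangementSum m M
      ≈⟨ fold-filter (λ σ → isPerm σ ∧ fixedPointFree σ) _ (allFuns m m) ⟩
    ∑ᶠ (λ σ → indicator (isPerm σ ∧ fixedPointFree σ) * (sign σ * prodFin m (λ j → M j (σ j))))
      ≈⟨ ∑ᶠ-cong (λ σ → deranged σ) ⟩
    ∑ᶠ (λ σ → indicator (isPerm σ) * (sign σ * prodFin m (λ j → M j (σ j))))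
      ≈⟨ fold-filter isPerm _ (allFuns m m) ⟨
    det m M ∎
    where
    deranged : ∀ σ → indicator (isPerm σ ∧ fixedPointFree σ) * (sign σ * prodFin m (λ j → M j (σ j)))
                   ≈ indicator (isPerm σ) * (sign σ * prodFin m (λ j → M j (σ j)))
    deranged σ with isPerm σ | fixedPointFree σ in eq
    ... | false | _ = refl
    ... | true | true = refl
    ... | true | false with fixedPointFree-false σ eq
    ... | i , σi≡i = trans (zeroˡ _) (sym (trans (*-identityˡ _)
      (trans (*-congˡ (trans (prodFin≈∏ m _) (∏-zero {m} _ i
        (trans (reflexive (≡.cong (M i) σi≡i)) (diagonal i))))) (zeroʳ _))))

  -- Reindexing by `σ ∘ swap i` merely reorders the factors of each product and negates each sign.
  leibniz-swap : ∀ {m} (M : Matrix (suc m)) i → leibniz (M ∘ swap i) ≈ - leibniz M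
  leibniz-swap {m} M i = begin
    leibniz (M ∘ swap i)                                ≈⟨ ∑ᶠ-swap _ (leibnizTerm-ext (M ∘ swap i)) i ⟨
    ∑ᶠ (λ σ → leibnizTerm (M ∘ swap i) (σ ∘ swap i))
      ≈⟨ ∑ᶠ-cong (λ σ → trans (*-cong (levi-swap σ i) (∏-swap (λ j → M j (σ j)) i))
           (trans (sym (-‿distribˡ-* _ _)) (sym (-1*x≈-x _)))) ⟩
    ∑ᶠ (λ σ → - 1# * leibnizTerm M σ)                   ≈⟨ fold-*ˡ (- 1#) (leibnizTerm M) (allFuns (suc m) (suc m)) ⟨
    - 1# * leibniz M                                    ≈⟨ -1*x≈-x _ ⟩
    - leibniz M ∎

  cancel-nonzero : ∀ {x y} → ¬ (x ≈ 0#) → x * y ≈ 0# → y ≈ 0#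
  cancel-nonzero {x} {y} x≉0 xy≈0 = begin
    y                  ≈⟨ *-identityˡ y ⟨
    1# * y             ≈⟨ *-congʳ (trans (*-comm _ _) (inverse x x≉0)) ⟨
    (x ⁻¹ * x) * y     ≈⟨ *-assoc _ _ _ ⟩
    x ⁻¹ * (x * y)     ≈⟨ trans (*-congˡ xy≈0) (zeroʳ _) ⟩
    0#                 ∎

  ι≉0 : ∀ m → ¬ (ι (suc m) ≈ 0#)
  ι≉0 m e with charZero (suc m) e
  ... | ()

  x≈-x⇒x≈0 : ∀ {x} → x ≈ - x → x ≈ 0#
  x≈-x⇒x≈0 {x} e = cancel-nonzero (ι≉0 1) (begin
    ι 2 * x     ≈⟨ solve 1 (λ x → (con 1 :+ (con 1 :+ con 0)) :* x := x :+ x) refl x ⟩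
    x + x       ≈⟨ +-congˡ e ⟩
    x + - x     ≈⟨ -‿inverseʳ x ⟩
    0#          ∎)

  -- Both sides change sign under adjacent swaps of τ, so it suffices to compare them on monotone τ.
  leibniz-rows : ∀ {m} (M : Matrix m) (τ : Fin m → Fin m) → leibniz (M ∘ τ) ≈ levi τ * leibniz M
  leibniz-rows {zero} M τ = trans (leibniz-cong {zero} {M ∘ τ} {M} λ ()) (sym (*-identityˡ _))
  leibniz-rows {suc m} M = sorting m (λ τ → leibniz (M ∘ τ) ≈ levi τ * leibniz M) resp unswap base
    where
    resp : ∀ {σ τ} → σ ≗ τ → leibniz (M ∘ σ) ≈ levi σ * leibniz M → leibniz (M ∘ τ) ≈ levi τ * leibniz M
    resp e eq = trans (leibniz-cong λ i j → reflexive (≡.cong (λ r → M r j) (≡.sym (e i))))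
      (trans eq (*-congʳ (levi-cong e)))
    unswap : ∀ i σ → leibniz (M ∘ σ ∘ swap i) ≈ levi (σ ∘ swap i) * leibniz M →
      leibniz (M ∘ σ) ≈ levi σ * leibniz M
    unswap i σ eq = begin
      leibniz (M ∘ σ)                       ≈⟨ -‿involutive _ ⟨
      - - leibniz (M ∘ σ)                   ≈⟨ -‿cong (leibniz-swap (M ∘ σ) i) ⟨
      - leibniz (M ∘ σ ∘ swap i)            ≈⟨ -‿cong eq ⟩
      - (levi (σ ∘ swap i) * leibniz M)     ≈⟨ -‿cong (*-congʳ (levi-swap σ i)) ⟩
      - (- levi σ * leibniz M)              ≈⟨ -‿distribˡ-* _ _ ⟩
      - - levi σ * leibniz M                ≈⟨ *-congʳ (-‿involutive _) ⟩
      levi σ * leibniz M ∎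
    base : ∀ τ → Monotone τ → leibniz (M ∘ τ) ≈ levi τ * leibniz M
    base τ mono with monotone⇒id⊎repeats τ mono
    ... | inj₁ τ≗id = resp {id} (≡.sym ∘ τ≗id) (sym (trans (*-congʳ (levi-id (suc m))) (*-identityˡ _)))
    -- Exchanging the two equal values changes neither side and negates both, so both are 0.
    ... | inj₂ (i , eq) = trans
      (x≈-x⇒x≈0 (trans (leibniz-cong λ r j → reflexive (≡.cong (λ r → M r j) (≡.sym (swap-fixes τ i eq r))))
        (leibniz-swap (M ∘ τ) i)))
      (sym (trans (*-congʳ (x≈-x⇒x≈0 (trans (levi-cong (≡.sym ∘ swap-fixes τ i eq)) (levi-swap τ i)))) (zeroˡ _)))

  infixl 7 _⊗_
  _⊗_ : ∀ {m} → Matrix m → Matrix m → Matrix m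
  (A ⊗ B) i k = sum λ j → A i j * B j k

  -- Each product of row sums expands over all choices τ of middle indices. For fixed τ the sum over
  -- σ is the Leibniz sum of `B` with rows selected by τ, which is `levi τ * leibniz B`; choices
  -- that are not injective drop out by themselves.
  leibniz-⊗ : ∀ {m} (A B : Matrix m) → leibniz (A ⊗ B) ≈ leibniz A * leibniz B
  leibniz-⊗ {m} A B = begin
    leibniz (A ⊗ B)
      ≈⟨ ∑ᶠ-cong (λ σ → trans (*-congˡ {levi σ} (∏-sum λ j k → A j k * B k (σ j)))
           (fold-*ˡ (levi σ) _ (allFuns m m))) ⟩
    ∑ᶠ (λ σ → ∑ᶠ (λ τ → levi σ * ∏ (λ j → A j (τ j) * B (τ j) (σ j))))
      ≈⟨ fold-comm _ (allFuns m m) (allFuns m m) ⟩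
    ∑ᶠ (λ τ → ∑ᶠ (λ σ → levi σ * ∏ (λ j → A j (τ j) * B (τ j) (σ j))))
      ≈⟨ ∑ᶠ-cong (λ τ → trans (∑ᶠ-cong (term τ)) (sym (fold-*ˡ _ _ (allFuns m m)))) ⟩
    ∑ᶠ (λ τ → ∏ (λ j → A j (τ j)) * leibniz (B ∘ τ))
      ≈⟨ ∑ᶠ-cong (λ τ → trans (*-congˡ (leibniz-rows B τ))
           (solve 3 (λ p l b → p :* (l :* b) := b :* (l :* p)) refl _ _ _)) ⟩
    ∑ᶠ (λ τ → leibniz B * leibnizTerm A τ)
      ≈⟨ fold-*ˡ (leibniz B) (leibnizTerm A) (allFuns m m) ⟨
    leibniz B * leibniz A
      ≈⟨ *-comm _ _ ⟩
    leibniz A * leibniz B ∎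
    where
    term : ∀ τ σ → levi σ * ∏ (λ j → A j (τ j) * B (τ j) (σ j))
                 ≈ ∏ (λ j → A j (τ j)) * leibnizTerm (B ∘ τ) σ
    term τ σ = trans (*-congˡ (∏-distrib {m} _ _))
      (solve 3 (λ l p q → l :* (p :* q) := p :* (l :* q)) refl _ _ _)

  -- Triangular expansions, diagonal matrices and constant shifts

  levi-suc : ∀ {m k} (σ : Fin m → Fin k) → levi {m} {suc k} (λ j → suc (σ j)) ≈ levi σ
  levi-suc {zero} σ = refl
  levi-suc {suc m} σ = *-congˡ (levi-suc (σ ∘ suc))

  levi-pigeonhole : ∀ {m} (σ : Fin (suc m) → Fin m) → levi σ ≈ 0#
  levi-pigeonhole σ with Fin.pigeonhole (ℕ.n<1+n _) σ
  ... | i , j , i<j , eq = levi-repeat σ i j i<j eq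

  leibnizTerm-zero : ∀ {m} (M : Matrix m) σ j → M j (σ j) ≈ 0# → leibnizTerm M σ ≈ 0#
  leibnizTerm-zero {m} M σ j e = trans (*-congˡ (∏-zero {m} _ j e)) (zeroʳ _)

  minor : ∀ {m} → Matrix (suc m) → Matrix m
  minor M i j = M (suc i) (suc j)

  private
    expanded : ∀ {m} (M : Matrix (suc m)) → (Fin m → Fin (suc m)) → Carrier
    expanded M f = sum λ i → leibnizTerm M (cons i f)

    corner : ∀ {m} (M : Matrix (suc m)) f →
      leibnizTerm M (cons zero (suc ∘ f)) ≈ M zero zero * leibnizTerm (minor M) f
    corner {m} M f = trans
      (*-congʳ (trans (*-cong (∏-ones m) (levi-suc f)) (*-identityˡ _)))
      (solve 3 (λ l a p → l :* (a :* p) := a :* (l :* p)) refl _ _ _)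

  -- The zero entries force the first value to be `zero`, and the symbol then forbids `zero` as any
  -- later value.
  leibniz-row₀ : ∀ {m} (M : Matrix (suc m)) → (∀ j → M zero (suc j) ≈ 0#) →
    leibniz M ≈ M zero zero * leibniz (minor M)
  leibniz-row₀ {m} M row₀ = begin
    leibniz M
      ≈⟨ fold-allFuns m (leibnizTerm M) ⟩
    ∑ᶠ (expanded M)
      ≈⟨ ∑ᶠ-cong {m} {suc m} (λ f → trans (+-congˡ (sum-zero {m} _ λ i →
           leibnizTerm-zero M (cons (suc i) f) zero (row₀ i))) (+-identityʳ _)) ⟩
    ∑ᶠ (leibnizTerm M ∘ cons zero)
      ≈⟨ ∑ᶠ-avoiding-zero _ (λ e → leibnizTerm-ext M (cons-cong zero e))
           (λ f j eq → trans (*-congʳ (levi-repeat (cons zero f) zero (suc j) ℕ.z<s (≡.sym eq))) (zeroˡ _)) ⟩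
    ∑ᶠ (λ f → leibnizTerm M (cons zero (suc ∘ f)))
      ≈⟨ ∑ᶠ-cong (corner M) ⟩
    ∑ᶠ (λ f → M zero zero * leibnizTerm (minor M) f)
      ≈⟨ fold-*ˡ _ _ (allFuns m m) ⟨
    M zero zero * leibniz (minor M) ∎

  -- The zero entries forbid `zero` as a later value. If the first value is not `zero` either, then
  -- m + 1 rows are sent to m columns, and the symbol vanishes by the pigeonhole principle.
  leibniz-column₀ : ∀ {m} (M : Matrix (suc m)) → (∀ i → M (suc i) zero ≈ 0#) →
    leibniz M ≈ M zero zero * leibniz (minor M)
  leibniz-column₀ {m} M column₀ = begin
    leibniz M
      ≈⟨ fold-allFuns m (leibnizTerm M) ⟩
    ∑ᶠ (expanded M)
      ≈⟨ ∑ᶠ-avoiding-zero (expanded M) (λ e → sum-cong-≋ {suc m} λ i → leibnizTerm-ext M (cons-cong i e))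
           (λ f j eq → sum-zero {suc m} _ λ i → leibnizTerm-zero M (cons i f) (suc j)
             (trans (reflexive (≡.cong (M (suc j)) eq)) (column₀ j))) ⟩
    ∑ᶠ (λ f → expanded M (suc ∘ f))
      ≈⟨ ∑ᶠ-cong {m} {m} (λ f → trans (+-cong (corner M f) (sum-zero {m} _ λ i → trans (*-congʳ
           (trans (levi-cong (cons-suc i f)) (trans (levi-suc (cons i f)) (levi-pigeonhole (cons i f)))))
           (zeroˡ _))) (+-identityʳ _)) ⟩
    ∑ᶠ (λ f → M zero zero * leibnizTerm (minor M) f)
      ≈⟨ fold-*ˡ _ _ (allFuns m m) ⟨
    M zero zero * leibniz (minor M) ∎

  diag : ∀ {m} → (Fin m → Carrier) → Matrix m
  diag d j k = if does (j Fin.≟ k) then d j else 0#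

  leibniz-diag : ∀ {m} (d : Fin m → Carrier) → leibniz (diag d) ≈ ∏ d
  leibniz-diag {zero} d = trans (+-identityʳ _) (*-identityˡ _)
  leibniz-diag {suc m} d = trans (leibniz-row₀ (diag d) λ _ → refl) (*-congˡ (leibniz-diag (d ∘ suc)))

  sum-diagˡ : ∀ {m} (d t : Fin m → Carrier) i → sum (λ j → diag d i j * t j) ≈ d i * t i
  sum-diagˡ {suc m} d t zero = trans (+-congˡ (sum-zero {m} _ λ j → zeroˡ _)) (+-identityʳ _)
  sum-diagˡ d t (suc i) = trans (+-cong (zeroˡ _) (sum-diagˡ (d ∘ suc) (t ∘ suc) i)) (+-identityˡ _)

  sum-diagʳ : ∀ {m} (d t : Fin m → Carrier) k → sum (λ j → t j * diag d j k) ≈ t k * d k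
  sum-diagʳ {suc m} d t zero = trans (+-congˡ (sum-zero {m} _ λ j → zeroʳ _)) (+-identityʳ _)
  sum-diagʳ d t (suc i) = trans (+-cong (zeroʳ _) (sum-diagʳ (d ∘ suc) (t ∘ suc) i)) (+-identityˡ _)

  bordered : ∀ {m} → Carrier → (Fin m → Carrier) → (Fin m → Carrier) → Matrix m → Matrix (suc m)
  bordered a r v N zero zero = a
  bordered a r v N zero (suc k) = r k
  bordered a r v N (suc j) zero = v j
  bordered a r v N (suc j) (suc k) = N j k

  -- The matrix with corner 1, top row -x, left column 1 and minor diag d factors as block lower
  -- times block upper triangular, and as block upper times block lower triangular.
  leibniz-diag+const : ∀ {m} (d d′ : Fin m → Carrier) → (∀ j → d j * d′ j ≈ 1#) → ∀ x →
    leibniz (λ j k → x + diag d j k) ≈ ∏ d * (1# + x * sum d′)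
  leibniz-diag+const {m} d d′ dd′ x = begin
    leibniz N                                  ≈⟨ trans (*-congʳ one) (*-identityˡ _) ⟨
    (1# * leibniz I) * leibniz N               ≈⟨ *-cong (leibniz-row₀ L₁ λ _ → refl)
                                                    (trans (leibniz-column₀ U₁ λ _ → refl) (*-identityˡ _)) ⟨
    leibniz L₁ * leibniz U₁                    ≈⟨ leibniz-⊗ L₁ U₁ ⟨
    leibniz (L₁ ⊗ U₁)                          ≈⟨ leibniz-cong (λ i k → trans (L₁U₁ i k) (sym (U₂L₂ i k))) ⟩
    leibniz (U₂ ⊗ L₂)                          ≈⟨ leibniz-⊗ U₂ L₂ ⟩
    leibniz U₂ * leibniz L₂                    ≈⟨ *-cong (trans (leibniz-column₀ U₂ λ _ → refl) one)
                                                    (leibniz-row₀ L₂ λ _ → refl) ⟩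
    1# * (s * leibniz (diag d))                ≈⟨ *-identityˡ _ ⟩
    s * leibniz (diag d)                       ≈⟨ trans (*-congˡ (leibniz-diag d)) (*-comm _ _) ⟩
    ∏ d * s ∎
    where
    s = 1# + x * sum d′
    N I : Matrix m
    N j k = x + diag d j k
    I = diag (λ _ → 1#)
    one : 1# * leibniz I ≈ 1#
    one = trans (*-identityˡ _) (trans (leibniz-diag {m} _) (∏-ones m))
    B L₁ U₁ U₂ L₂ : Matrix (suc m)
    B = bordered 1# (λ _ → - x) (λ _ → 1#) (diag d)
    L₁ = bordered 1# (λ _ → 0#) (λ _ → 1#) I
    U₁ = bordered 1# (λ _ → - x) (λ _ → 0#) N
    U₂ = bordered 1# (λ j → - x * d′ j) (λ _ → 0#) I
    L₂ = bordered s (λ _ → 0#) (λ _ → 1#) (diag d)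
    L₁U₁ : ∀ i k → (L₁ ⊗ U₁) i k ≈ B i k
    L₁U₁ zero zero = trans (+-cong (*-identityˡ _) (sum-zero {m} _ λ _ → zeroˡ _)) (+-identityʳ _)
    L₁U₁ zero (suc k) = trans (+-cong (*-identityˡ _) (sum-zero {m} _ λ _ → zeroˡ _)) (+-identityʳ _)
    L₁U₁ (suc j) zero = trans (+-cong (*-identityˡ _) (sum-zero {m} _ λ _ → zeroʳ _)) (+-identityʳ _)
    L₁U₁ (suc j) (suc k) = begin
      1# * - x + sum (λ l → I j l * N l k)  ≈⟨ +-cong (*-identityˡ _) (trans (sum-diagˡ _ (λ l → N l k) j) (*-identityˡ _)) ⟩
      - x + (x + diag d j k)                ≈⟨ +-assoc _ _ _ ⟨
      (- x + x) + diag d j k                ≈⟨ trans (+-congʳ (-‿inverseˡ x)) (+-identityˡ _) ⟩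
      diag d j k ∎
    U₂L₂ : ∀ i k → (U₂ ⊗ L₂) i k ≈ B i k
    U₂L₂ zero zero = begin
      1# * s + sum (λ j → - x * d′ j * 1#)  ≈⟨ +-cong (*-identityˡ s) (trans (sum-cong-≋ {m} λ j → *-identityʳ _)
                                                 (sym (*-distribˡ-sum (- x) d′))) ⟩
      (1# + x * sum d′) + - x * sum d′      ≈⟨ +-assoc _ _ _ ⟩
      1# + (x * sum d′ + - x * sum d′)      ≈⟨ +-congˡ (trans (sym (distribʳ _ _ _)) (trans (*-congʳ (-‿inverseʳ x)) (zeroˡ _))) ⟩
      1# + 0#                               ≈⟨ +-identityʳ _ ⟩
      1# ∎
    U₂L₂ zero (suc k) = begin
      1# * 0# + sum (λ j → - x * d′ j * diag d j k)  ≈⟨ +-cong (zeroʳ _) (sum-diagʳ d (λ j → - x * d′ j) k) ⟩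
      0# + - x * d′ k * d k                          ≈⟨ trans (+-identityˡ _) (*-assoc _ _ _) ⟩
      - x * (d′ k * d k)                             ≈⟨ *-congˡ (trans (*-comm _ _) (dd′ k)) ⟩
      - x * 1#                                       ≈⟨ *-identityʳ _ ⟩
      - x ∎
    U₂L₂ (suc j) zero = trans (+-cong (zeroˡ _) (trans (sum-diagˡ _ (λ _ → 1#) j) (*-identityˡ _))) (+-identityˡ _)
    U₂L₂ (suc j) (suc k) = trans (+-cong (zeroˡ _) (trans (sum-diagˡ _ (λ l → diag d l k) j) (*-identityˡ _))) (+-identityˡ _)

-- Powers, geometric sums and the product of the numbers n - 2r

module RootsOfUnity {c ℓ : Level} (F : Field c ℓ) (charZero : FieldOps.CharZero F)
  (h : ℕ) (ζ : Field.Carrier F) (prim : FieldOps.PrimitiveRoot F (suc (h ℕ.* 2)) ζ) where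
  open Field F hiding (zero)
  open FieldOps F
  open Determinants F charZero
  open import Algebra.Properties.Ring ring using (x≈z//y; +-cancelˡ; +-cancelʳ)
  open import Relation.Binary.Reasoning.Setoid setoid
  open import Algebra.Solver.Ring.NaturalCoefficients.Default commutativeSemiring
    using (solve; _:+_; _:*_; _:=_; con)

  -- `_⁻¹` is not assumed to respect `≈`; this identifies the inverse of an element known only up to
  -- `≈`.
  inverse-unique : ∀ {x y} → ¬ (x ≈ 0#) → x * y ≈ 1# → y ≈ x ⁻¹
  inverse-unique {x} {y} x≉0 xy≈1 = begin
    y                ≈⟨ *-identityʳ y ⟨
    y * 1#           ≈⟨ *-congˡ (inverse x x≉0) ⟨
    y * (x * x ⁻¹)   ≈⟨ solve 3 (λ x y z → y :* (x :* z) := (x :* y) :* z) refl x y (x ⁻¹) ⟩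
    (x * y) * x ⁻¹   ≈⟨ trans (*-congʳ xy≈1) (*-identityˡ _) ⟩
    x ⁻¹ ∎

  ι-+ : ∀ a b → ι (a ℕ.+ b) ≈ ι a + ι b
  ι-+ zero b = sym (+-identityˡ _)
  ι-+ (suc a) b = trans (+-congˡ (ι-+ a b)) (sym (+-assoc _ _ _))

  ι-* : ∀ a b → ι (a ℕ.* b) ≈ ι a * ι b
  ι-* zero b = sym (zeroˡ _)
  ι-* (suc a) b = trans (ι-+ b (a ℕ.* b)) (trans (+-congˡ (ι-* a b))
    (solve 2 (λ a b → b :+ a :* b := (con 1 :+ a) :* b) refl (ι a) (ι b)))

  ι-injective : ∀ a b → ι a ≈ ι b → a ≡ b
  ι-injective zero b e = ≡.sym (charZero b (sym e))
  ι-injective (suc a) zero e = charZero (suc a) e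
  ι-injective (suc a) (suc b) e = ≡.cong suc (ι-injective a b (+-cancelˡ _ _ _ e))

  ^-cong : ∀ {x y} n → x ≈ y → x ^ n ≈ y ^ n
  ^-cong zero e = refl
  ^-cong (suc n) e = *-cong e (^-cong n e)

  1^ : ∀ n → 1# ^ n ≈ 1#
  1^ zero = refl
  1^ (suc n) = trans (*-identityˡ _) (1^ n)

  ^-+ : ∀ x a b → x ^ (a ℕ.+ b) ≈ x ^ a * x ^ b
  ^-+ x zero b = sym (*-identityˡ _)
  ^-+ x (suc a) b = trans (*-congˡ (^-+ x a b)) (sym (*-assoc _ _ _))

  ^-distrib-* : ∀ x y n → (x * y) ^ n ≈ x ^ n * y ^ n
  ^-distrib-* x y zero = sym (*-identityˡ _)
  ^-distrib-* x y (suc n) = trans (*-congˡ (^-distrib-* x y n))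
    (solve 4 (λ a b c d → (a :* b) :* (c :* d) := (a :* c) :* (b :* d)) refl _ _ _ _)

  ^-^-one : ∀ x n a → x ^ n ≈ 1# → (x ^ a) ^ n ≈ 1#
  ^-^-one x n zero e = 1^ n
  ^-^-one x n (suc a) e = trans (^-distrib-* x (x ^ a) n)
    (trans (*-cong e (^-^-one x n a e)) (*-identityˡ _))

  -- The identity (1 - z) Σ z^i = 1 - z^n with its terms moved across, so that no subtraction occurs
  -- and the semiring solver applies.
  geometric : ∀ z n → 1# + z * sum {n} (λ i → z ^ toℕ i) ≈ sum {n} (λ i → z ^ toℕ i) + z ^ n
  geometric z zero = trans (+-comm _ _) (+-congʳ (zeroʳ z))
  geometric z (suc n) = begin
    1# + z * (1# + t)           ≈⟨ +-congˡ (*-congˡ (+-congˡ shift)) ⟩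
    1# + z * (1# + z * g)       ≈⟨ +-congˡ (*-congˡ (geometric z n)) ⟩
    1# + z * (g + z ^ n)        ≈⟨ solve 3 (λ z g p → con 1 :+ z :* (g :+ p) := (con 1 :+ z :* g) :+ z :* p)
                                     refl z g (z ^ n) ⟩
    (1# + z * g) + z * z ^ n    ≈⟨ +-congʳ (+-congˡ shift) ⟨
    (1# + t) + z * z ^ n ∎
    where
    g = sum {n} (λ i → z ^ toℕ i)
    t = sum {n} (λ i → z ^ suc (toℕ i))
    shift : t ≈ z * g
    shift = sym (*-distribˡ-sum z (λ (i : Fin n) → z ^ toℕ i))

  -- Replacing each weight in z Σ w_i z^i by its successor plus 2 reproduces the original sum
  -- shifted by one place. What remains is the two boundary terms and twice a geometric sum.
  summation-by-parts : ∀ z n (w : ℕ → Carrier) → (∀ i → w i ≈ w (suc i) + ι 2) →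
    sum {n} (λ i → w (toℕ i) * z ^ toℕ i) + ι 2 * sum {n} (λ i → z ^ suc (toℕ i)) + w n * z ^ n
      ≈ w 0 + z * sum {n} (λ i → w (toℕ i) * z ^ toℕ i)
  summation-by-parts z zero w step =
    solve 2 (λ z w → (con 0 :+ (con 1 :+ (con 1 :+ con 0)) :* con 0) :+ w :* con 1 := w :+ z :* con 0)
      refl z (w 0)
  summation-by-parts z (suc n) w step = begin
    (w 0 * 1# + t) + ι 2 * (z * 1# + sum {n} (λ i → z * z ^ suc (toℕ i))) + w (suc n) * (z * z ^ n)
      ≈⟨ +-congʳ (+-cong (+-congˡ shift) (*-congˡ (+-congˡ (sym (*-distribˡ-sum z (λ (i : Fin n) → z ^ suc (toℕ i))))))) ⟩
    (w 0 * 1# + z * g) + ι 2 * (z * 1# + z * p) + w (suc n) * (z * z ^ n)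
      ≈⟨ solve 7 (λ w₀ z g t p v q → (w₀ :* con 1 :+ z :* g) :+ t :* (z :* con 1 :+ z :* p) :+ v :* (z :* q)
                     := w₀ :+ z :* (t :+ ((g :+ t :* p) :+ v :* q)))
           refl (w 0) z g (ι 2) p (w (suc n)) (z ^ n) ⟩
    w 0 + z * (ι 2 + (g + ι 2 * p + w (suc n) * z ^ n))
      ≈⟨ +-congˡ (*-congˡ (+-congˡ (summation-by-parts z n (w ∘ suc) (step ∘ suc)))) ⟩
    w 0 + z * (ι 2 + (w 1 + z * g))
      ≈⟨ +-congˡ (*-congˡ (trans (sym (+-assoc _ _ _)) (+-congʳ (trans (+-comm _ _) (sym (step 0)))))) ⟩
    w 0 + z * (w 0 + z * g)
      ≈⟨ +-congˡ (*-congˡ (+-cong (*-identityʳ _) shift)) ⟨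
    w 0 + z * (w 0 * 1# + t) ∎
    where
    g = sum {n} (λ i → w (suc (toℕ i)) * z ^ toℕ i)
    t = sum {n} (λ i → w (suc (toℕ i)) * (z * z ^ toℕ i))
    p = sum {n} (λ i → z ^ suc (toℕ i))
    shift : t ≈ z * g
    shift = trans (sum-cong-≋ {n} λ i → solve 3 (λ w z q → w :* (z :* q) := z :* (w :* q)) refl _ _ _)
      (sym (*-distribˡ-sum z (λ (i : Fin n) → w (suc (toℕ i)) * z ^ toℕ i)))

  -- Reversing the order of summation negates the sum, and 2 is nonzero.
  sum-antisymmetric : ∀ {m} (f : Fin m → Carrier) → (∀ i → f (Fin.opposite i) ≈ - f i) → sum f ≈ 0#
  sum-antisymmetric {m} f anti = x≈-x⇒x≈0 (begin
    sum f                          ≈⟨ sum-permute f reverse ⟩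
    sum (λ i → f (Fin.opposite i)) ≈⟨ sum-cong-≋ {m} (λ i → trans (anti i) (sym (-1*x≈-x _))) ⟩
    sum (λ i → - 1# * f i)         ≈⟨ *-distribˡ-sum (- 1#) f ⟨
    - 1# * sum f                   ≈⟨ -1*x≈-x _ ⟩
    - sum f ∎)

  -- linear n r = n − 2r, which is λ_r for 1 ≤ r ≤ n − 1.
  linear : ℕ → ℕ → Carrier
  linear n i = ι n - (ι i + ι i)

  linear-spec : ∀ n i → linear n i + (ι i + ι i) ≈ ι n
  linear-spec n i = trans (+-assoc _ _ _) (trans (+-congˡ (-‿inverseˡ _)) (+-identityʳ _))

  linear-unique : ∀ n i {x} → x + (ι i + ι i) ≈ ι n → x ≈ linear n i
  linear-unique n i {x} = x≈z//y x (ι i + ι i) (ι n)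

  linear-step : ∀ n i → linear n i ≈ linear n (suc i) + ι 2
  linear-step n i = sym (linear-unique n i (trans
    (solve 2 (λ l i → (l :+ (con 1 :+ (con 1 :+ con 0))) :+ (i :+ i) := l :+ ((con 1 :+ i) :+ (con 1 :+ i)))
      refl (linear n (suc i)) (ι i)) (linear-spec n (suc i))))

  linear-reflect : ∀ n i j → i ℕ.+ j ≡ n → linear n j ≈ - linear n i
  linear-reflect n i j i+j≡n = trans (sym (+-identityʳ _)) (trans (+-congˡ (sym (-‿inverseʳ (linear n i))))
    (trans (sym (+-assoc _ _ _)) (trans (+-congʳ cancelled) (+-identityˡ _))))
    where
    cancelled : linear n j + linear n i ≈ 0#
    -- Adding 2n, written as 2(i + j), pays for both subtractions hidden in `linear`.
    cancelled = +-cancelʳ (ι n + ι n) _ _ (begin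
      (linear n j + linear n i) + (ι n + ι n)
        ≈⟨ +-congˡ (+-cong ι-sum ι-sum) ⟩
      (linear n j + linear n i) + ((ι i + ι j) + (ι i + ι j))
        ≈⟨ solve 4 (λ u v i j → (u :+ v) :+ ((i :+ j) :+ (i :+ j)) := (u :+ (j :+ j)) :+ (v :+ (i :+ i)))
             refl (linear n j) (linear n i) (ι i) (ι j) ⟩
      (linear n j + (ι j + ι j)) + (linear n i + (ι i + ι i))
        ≈⟨ +-cong (linear-spec n j) (linear-spec n i) ⟩
      ι n + ι n
        ≈⟨ +-identityˡ _ ⟨
      0# + (ι n + ι n) ∎)
      where
      ι-sum : ι n ≈ ι i + ι j
      ι-sum = trans (reflexive (≡.cong ι (≡.sym i+j≡n))) (ι-+ i j)

  -- At `k = 0` truncated subtraction makes (-1)!! into `0 !!`, whose value 1 is the one that the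
  -- recursion calls for.
  odd-!! : ∀ k → (suc k ℕ.* 2 ∸ 1) !! ≡ suc (k ℕ.* 2) ℕ.* (k ℕ.* 2 ∸ 1) !!
  odd-!! zero = ≡.refl
  odd-!! (suc k) = ≡.refl

  -- Passing from 2k + 1 to 2k + 3 moves the old factors one place inward and adds 2k + 1 at the
  -- front and -(2k + 1) at the end.
  ∏-linear : ∀ k → ∏ {k ℕ.* 2} (λ i → linear (suc (k ℕ.* 2)) (suc (toℕ i)))
                 ≈ (- 1#) ^ k * ι ((k ℕ.* 2 ∸ 1) !!) ^ 2
  ∏-linear zero = solve 0 (con 1 := con 1 :* ((con 1 :+ con 0) :* ((con 1 :+ con 0) :* con 1))) refl
  ∏-linear (suc k) = begin
    linear N 1 * ∏ {suc (k ℕ.* 2)} (λ i → linear N (suc (suc (toℕ i))))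
      ≈⟨ *-cong (sym (linear-unique N 1 first)) (∏-init-last {k ℕ.* 2} (λ i → linear N (suc (suc (toℕ i))))) ⟩
    p * (∏ {k ℕ.* 2} (λ i → linear N (suc (suc (toℕ (inject₁ i))))) * linear N (suc (suc (toℕ (Fin.fromℕ (k ℕ.* 2))))))
      ≈⟨ *-congˡ (*-cong (∏-cong {k ℕ.* 2} middle) final) ⟩
    p * (∏ {k ℕ.* 2} (λ i → linear n′ (suc (toℕ i))) * (- 1# * p))
      ≈⟨ *-congˡ (*-congʳ (∏-linear k)) ⟩
    p * (((- 1#) ^ k * ι q ^ 2) * (- 1# * p))
      ≈⟨ solve 4 (λ p s q u → p :* ((s :* (q :* (q :* con 1))) :* (u :* p))
                    := (u :* s) :* ((p :* q) :* ((p :* q) :* con 1))) refl p ((- 1#) ^ k) (ι q) (- 1#) ⟩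
    (- 1#) ^ suc k * (p * ι q) ^ 2
      ≈⟨ *-congˡ (^-cong 2 (trans (reflexive (≡.cong ι (odd-!! k))) (ι-* n′ q))) ⟨
    (- 1#) ^ suc k * ι ((suc k ℕ.* 2 ∸ 1) !!) ^ 2 ∎
    where
    n′ = suc (k ℕ.* 2)
    N = suc (suc n′)
    q = (k ℕ.* 2 ∸ 1) !!
    p = ι n′
    first : p + (ι 1 + ι 1) ≈ ι N
    first = solve 1 (λ p → p :+ ((con 1 :+ con 0) :+ (con 1 :+ con 0)) := con 1 :+ (con 1 :+ p)) refl p
    middle : ∀ i → linear N (suc (suc (toℕ (inject₁ i)))) ≈ linear n′ (suc (toℕ i))
    middle i = trans (reflexive (≡.cong (λ t → linear N (suc (suc t))) (Fin.toℕ-inject₁ i)))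
      (sym (linear-unique N (suc (suc (toℕ i))) (trans
        (solve 2 (λ l i → l :+ ((con 1 :+ i) :+ (con 1 :+ i)) := con 1 :+ con 1 :+ (l :+ (i :+ i)))
          refl (linear n′ (suc (toℕ i))) (ι (suc (toℕ i))))
        (trans (+-congˡ (linear-spec n′ (suc (toℕ i)))) (+-assoc _ _ _)))))
    final : linear N (suc (suc (toℕ (Fin.fromℕ (k ℕ.* 2))))) ≈ - 1# * p
    final = trans (reflexive (≡.cong (λ t → linear N (suc (suc t))) (Fin.toℕ-fromℕ (k ℕ.* 2))))
      (trans (linear-reflect N 1 (suc n′) ≡.refl)
        (trans (-‿cong (sym (linear-unique N 1 first))) (sym (-1*x≈-x p))))

  -- The powers of ζ and sums over them

  m n : ℕ
  m = h ℕ.* 2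
  n = suc m

  ν : Carrier
  ν = ι n

  νν⁻¹≈1 : ν * ν ⁻¹ ≈ 1#
  νν⁻¹≈1 = inverse ν (ι≉0 m)

  ζⁿ≈1 : ζ ^ n ≈ 1#
  ζⁿ≈1 = proj₁ prim

  ζζ⁻¹≈1 : ζ * ζ ⁻¹ ≈ 1#
  ζζ⁻¹≈1 = inverse ζ λ ζ≈0 → 0≉1 (trans (sym (trans (*-congʳ ζ≈0) (zeroˡ (ζ ^ m)))) ζⁿ≈1)

  ζ^ζ⁻¹^≈1 : ∀ k → ζ ^ k * (ζ ⁻¹) ^ k ≈ 1#
  ζ^ζ⁻¹^≈1 k = trans (sym (^-distrib-* ζ (ζ ⁻¹) k)) (trans (^-cong k ζζ⁻¹≈1) (1^ k))

  ζ⁻¹ⁿ≈1 : (ζ ⁻¹) ^ n ≈ 1#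
  ζ⁻¹ⁿ≈1 = trans (sym (trans (*-congʳ ζⁿ≈1) (*-identityˡ _))) (ζ^ζ⁻¹^≈1 n)

  ζ^-distinct : ∀ {j k} → j < k → k < n → ¬ (ζ ^ j ≈ ζ ^ k)
  ζ^-distinct {j} {k} j<k k<n e = proj₂ prim (k ∸ j) (ℕ.m<n⇒0<n∸m j<k)
    (ℕ.≤-<-trans (ℕ.m∸n≤m k j) k<n) (begin
      ζ ^ (k ∸ j)                                ≈⟨ *-identityʳ _ ⟨
      ζ ^ (k ∸ j) * 1#                           ≈⟨ *-congˡ (ζ^ζ⁻¹^≈1 j) ⟨
      ζ ^ (k ∸ j) * (ζ ^ j * (ζ ⁻¹) ^ j)         ≈⟨ *-assoc _ _ _ ⟨
      (ζ ^ (k ∸ j) * ζ ^ j) * (ζ ⁻¹) ^ j         ≈⟨ *-congʳ (^-+ ζ (k ∸ j) j) ⟨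
      ζ ^ (k ∸ j ℕ.+ j) * (ζ ⁻¹) ^ j             ≡⟨ ≡.cong (λ t → ζ ^ t * (ζ ⁻¹) ^ j) (ℕ.m∸n+n≡m (ℕ.<⇒≤ j<k)) ⟩
      ζ ^ k * (ζ ⁻¹) ^ j                         ≈⟨ *-congʳ e ⟨
      ζ ^ j * (ζ ⁻¹) ^ j                         ≈⟨ ζ^ζ⁻¹^≈1 j ⟩
      1# ∎)

  -- This is ζ^(j-k) with nothing cancelled. Free of truncated subtraction, it distributes over
  -- powers and products, while `powDiff` first removes the common part of the exponents.
  ρ : ℕ → ℕ → Carrier
  ρ j k = ζ ^ j * (ζ ⁻¹) ^ k

  ρⁿ≈1 : ∀ j k → ρ j k ^ n ≈ 1#
  ρⁿ≈1 j k = trans (^-distrib-* (ζ ^ j) ((ζ ⁻¹) ^ k) n)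
    (trans (*-cong (^-^-one ζ n j ζⁿ≈1) (^-^-one (ζ ⁻¹) n k ζ⁻¹ⁿ≈1)) (*-identityˡ _))

  ρ≈1⇒ζ^≈ζ^ : ∀ j k → ρ j k ≈ 1# → ζ ^ j ≈ ζ ^ k
  ρ≈1⇒ζ^≈ζ^ j k e = begin
    ζ ^ j                            ≈⟨ trans (*-congˡ (ζ^ζ⁻¹^≈1 k)) (*-identityʳ _) ⟨
    ζ ^ j * (ζ ^ k * (ζ ⁻¹) ^ k)     ≈⟨ solve 3 (λ a b c → a :* (b :* c) := (a :* c) :* b) refl _ _ _ ⟩
    ρ j k * ζ ^ k                    ≈⟨ trans (*-congʳ e) (*-identityˡ _) ⟩
    ζ ^ k ∎

  ρ≉1 : ∀ j k → j < n → k < n → ¬ (j ≡ k) → ¬ (ρ j k ≈ 1#)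
  ρ≉1 j k j<n k<n j≢k e with ℕ.<-cmp j k
  ... | tri< j<k _ _ = ζ^-distinct j<k k<n (ρ≈1⇒ζ^≈ζ^ j k e)
  ... | tri≈ _ j≡k _ = j≢k j≡k
  ... | tri> _ _ k<j = ζ^-distinct k<j j<n (sym (ρ≈1⇒ζ^≈ζ^ j k e))

  ρ-suc : ∀ j k → ρ (suc j) (suc k) ≈ ρ j k
  ρ-suc j k = trans (solve 4 (λ a b c d → (a :* b) :* (c :* d) := (a :* c) :* (b :* d)) refl _ _ _ _)
    (trans (*-congʳ ζζ⁻¹≈1) (*-identityˡ _))

  powDiff≈ρ : ∀ j k → powDiff ζ j k ≈ ρ j k
  powDiff≈ρ zero zero = refl
  powDiff≈ρ zero (suc k) = refl
  powDiff≈ρ (suc j) zero = refl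
  powDiff≈ρ (suc j) (suc k) = trans (powDiff≈ρ j k) (sym (ρ-suc j k))

  module _ {z : Carrier} (zⁿ≈1 : z ^ n ≈ 1#) (z≉1 : ¬ (z ≈ 1#)) where
    1-z≉0 : ¬ (1# - z ≈ 0#)
    1-z≉0 e = z≉1 (sym (+-cancelʳ (- z) _ _ (trans e (sym (-‿inverseʳ z)))))

    -- Both power sums below satisfy an affine equation of this kind; dividing by 1 - z solves it.
    fixed⇒quotient : ∀ {x y} → x ≈ y + z * x → x ≈ y * (1# - z) ⁻¹
    fixed⇒quotient {x} {y} e = begin
      x                                  ≈⟨ trans (*-congˡ (inverse _ 1-z≉0)) (*-identityʳ _) ⟨
      x * ((1# - z) * (1# - z) ⁻¹)       ≈⟨ *-assoc _ _ _ ⟨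
      x * (1# - z) * (1# - z) ⁻¹         ≈⟨ *-congʳ x[1-z]≈y ⟩
      y * (1# - z) ⁻¹ ∎
      where
      x[1-z]≈y : x * (1# - z) ≈ y
      x[1-z]≈y = begin
        x * (1# - z)             ≈⟨ distribˡ _ _ _ ⟩
        x * 1# + x * - z         ≈⟨ +-cong (trans (*-identityʳ x) e) (trans (*-comm _ _) (sym (-‿distribˡ-* z x))) ⟩
        (y + z * x) + - (z * x)  ≈⟨ trans (+-assoc _ _ _) (trans (+-congˡ (-‿inverseʳ _)) (+-identityʳ _)) ⟩
        y ∎

    sum-roots : sum {n} (λ i → z ^ toℕ i) ≈ 0#
    sum-roots = trans (fixed⇒quotient (trans (sym zg≈g) (sym (+-identityˡ _)))) (zeroˡ _)
      where
      zg≈g : z * sum {n} (λ i → z ^ toℕ i) ≈ sum {n} (λ i → z ^ toℕ i)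
      zg≈g = +-cancelˡ 1# _ _ (trans (geometric z n) (trans (+-congˡ zⁿ≈1) (+-comm _ _)))

    sum-powers : sum {m} (λ i → z ^ suc (toℕ i)) ≈ - 1#
    sum-powers = +-cancelˡ 1# _ _ (trans sum-roots (sym (-‿inverseʳ 1#)))

    sum-linear-powers : sum {m} (λ i → linear n (suc (toℕ i)) * z ^ suc (toℕ i))
                      ≈ ν * ((1# + z) * (1# - z) ⁻¹)
    sum-linear-powers = trans (fixed⇒quotient fixed) (*-assoc _ _ _)
      where
      S T G : Carrier
      S = sum {m} (λ i → linear n (suc (toℕ i)) * z ^ suc (toℕ i))
      T = sum {n} (λ i → linear n (toℕ i) * z ^ toℕ i)
      G = sum {n} (λ i → z ^ suc (toℕ i))
      linear₀ : ν ≈ linear n 0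
      linear₀ = linear-unique n 0 (trans (+-congˡ (+-identityˡ _)) (+-identityʳ _))
      T≈ν+S : T ≈ ν + S
      T≈ν+S = +-congʳ (trans (*-identityʳ _) (sym linear₀))
      G≈0 : G ≈ 0#
      G≈0 = trans (sym (*-distribˡ-sum z (λ (i : Fin n) → z ^ toℕ i))) (trans (*-congˡ sum-roots) (zeroʳ z))
      fixed : S ≈ ν * (1# + z) + z * S
      fixed = begin
        S
          ≈⟨ trans (+-congʳ (-‿inverseʳ ν)) (+-identityˡ S) ⟨
        (ν + - ν) + S
          ≈⟨ solve 3 (λ a b s → (a :+ b) :+ s := ((a :+ s) :+ con 0) :+ b) refl ν (- ν) S ⟩
        ((ν + S) + 0#) + - ν
          -- The summand λ_0 = n completes S to T, the 0 is twice a full cycle of powers of z, and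
          -- -n is the boundary term λ_n z^n.
          ≈⟨ +-cong (+-cong (sym T≈ν+S) (sym (trans (*-congˡ G≈0) (zeroʳ _))))
               (trans (-‿cong linear₀) (sym (trans (*-congˡ zⁿ≈1) (trans (*-identityʳ _) (linear-reflect n 0 n ≡.refl))))) ⟩
        (T + ι 2 * G) + linear n n * z ^ n
          ≈⟨ summation-by-parts z n (linear n) (linear-step n) ⟩
        linear n 0 + z * T
          ≈⟨ +-cong (sym linear₀) (*-congˡ T≈ν+S) ⟩
        ν + z * (ν + S)
          ≈⟨ solve 3 (λ v z s → v :+ z :* (v :+ s) := v :* (con 1 :+ z) :+ z :* s) refl ν z S ⟩
        ν * (1# + z) + z * S ∎

  -- The eigenvalues n - 2r and the truncated Fourier matrices

  eigenvalue : Fin m → Carrier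
  eigenvalue i = linear n (suc (toℕ i))

  -- A zero would give 2s = n in the field, hence in the natural numbers by characteristic zero,
  -- against the parity of n.
  eigenvalue≉0 : ∀ i → ¬ (eigenvalue i ≈ 0#)
  eigenvalue≉0 i e = ℕ.even≢odd s h (≡.trans
    (ι-injective (2 ℕ.* s) n (trans (ι-* 2 s) (trans
      (solve 1 (λ s → (con 1 :+ (con 1 :+ con 0)) :* s := con 0 :+ (s :+ s)) refl (ι s))
      (trans (+-congʳ (sym e)) (linear-spec n s)))))
    (≡.cong suc (ℕ.*-comm h 2)))
    where s = suc (toℕ i)

  eigenvalue-opposite : ∀ i → eigenvalue (Fin.opposite i) ≈ - eigenvalue i
  eigenvalue-opposite i = linear-reflect n (suc (toℕ i)) (suc (toℕ (Fin.opposite i))) (≡.trans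
    (≡.cong (λ t → suc (toℕ i) ℕ.+ suc t) (Fin.opposite-prop i))
    (≡.trans (ℕ.+-suc (suc (toℕ i)) (m ∸ suc (toℕ i))) (≡.cong suc (ℕ.m+[n∸m]≡n (Fin.toℕ<n i)))))

  sum-eigenvalue : sum eigenvalue ≈ 0#
  sum-eigenvalue = sum-antisymmetric eigenvalue eigenvalue-opposite

  sum-eigenvalue⁻¹ : sum (λ i → eigenvalue i ⁻¹) ≈ 0#
  sum-eigenvalue⁻¹ = sum-antisymmetric {m} _ λ i → sym (inverse-unique (eigenvalue≉0 (Fin.opposite i)) (begin
    eigenvalue (Fin.opposite i) * - (eigenvalue i ⁻¹)   ≈⟨ *-congʳ (eigenvalue-opposite i) ⟩
    - eigenvalue i * - (eigenvalue i ⁻¹)                ≈⟨ -‿distribˡ-* _ _ ⟨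
    - (eigenvalue i * - (eigenvalue i ⁻¹))              ≈⟨ -‿cong (-‿distribʳ-* _ _) ⟨
    - - (eigenvalue i * eigenvalue i ⁻¹)                ≈⟨ -‿involutive _ ⟩
    eigenvalue i * eigenvalue i ⁻¹                      ≈⟨ inverse _ (eigenvalue≉0 i) ⟩
    1# ∎))

  -- The Fin m indices j, k, r stand for j + 1, k + 1, r + 1.
  V W : Matrix m
  V j r = ρ (suc (toℕ j)) 0 ^ suc (toℕ r)
  W r k = ρ 0 (suc (toℕ k)) ^ suc (toℕ r)

  -- Both entries are powers with exponent r + 1, so their product is a power of a single root of
  -- unity, the form that `sum-powers` and `sum-linear-powers` expect.
  VW : ∀ j r k → V j r * W r k ≈ ρ (toℕ j) (toℕ k) ^ suc (toℕ r)
  VW j r k = trans (sym (^-distrib-* _ _ (suc (toℕ r)))) (^-cong (suc (toℕ r))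
    (trans (*-cong (*-identityʳ _) (*-identityˡ _)) (ρ-suc (toℕ j) (toℕ k))))

  toℕ<n : ∀ (j : Fin m) → toℕ j < n
  toℕ<n j = ℕ.m<n⇒m<1+n (Fin.toℕ<n j)

  ρ-toℕ≉1 : ∀ {j k : Fin m} → ¬ (j ≡ k) → ¬ (ρ (toℕ j) (toℕ k) ≈ 1#)
  ρ-toℕ≉1 {j} {k} j≢k = ρ≉1 _ _ (toℕ<n j) (toℕ<n k) (j≢k ∘ Fin.toℕ-injective)

  ρ-diagonal : ∀ j t → ρ j j ^ t ≈ 1#
  ρ-diagonal j t = trans (^-cong t (ζ^ζ⁻¹^≈1 j)) (1^ t)

  sum-V : ∀ j → sum (V j) ≈ - 1#
  sum-V j = sum-powers (ρⁿ≈1 (suc (toℕ j)) 0) (ρ≉1 (suc (toℕ j)) 0 (ℕ.s≤s (Fin.toℕ<n j)) ℕ.z<s λ ())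

  sum-W : ∀ k → sum (λ r → W r k) ≈ - 1#
  sum-W k = sum-powers (ρⁿ≈1 0 (suc (toℕ k))) (ρ≉1 0 (suc (toℕ k)) ℕ.z<s (ℕ.s≤s (Fin.toℕ<n k)) λ ())

  sum-const : ∀ l x → sum {l} (λ _ → x) ≈ ι l * x
  sum-const zero x = sym (zeroˡ x)
  sum-const (suc l) x = trans (+-congˡ (sum-const l x))
    (solve 2 (λ l x → x :+ l :* x := (con 1 :+ l) :* x) refl (ι l) x)

  ∏ν*∏ν⁻¹≈1 : ∀ l → ∏ {l} (λ _ → ν) * ∏ {l} (λ _ → ν ⁻¹) ≈ 1#
  ∏ν*∏ν⁻¹≈1 l = trans (sym (∏-distrib {l} _ _)) (trans (∏-cong {l} λ _ → νν⁻¹≈1) (∏-ones l))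

  V⊗W : ∀ j k → (V ⊗ W) j k ≈ - 1# + diag (λ _ → ν) j k
  V⊗W j k with j Fin.≟ k
  ... | yes ≡.refl = begin
    sum (λ r → V j r * W r j)  ≈⟨ sum-cong-≋ {m} (λ r → trans (VW j r j) (ρ-diagonal (toℕ j) (suc (toℕ r)))) ⟩
    sum {m} (λ _ → 1#)         ≈⟨ trans (sum-const m 1#) (*-identityʳ _) ⟩
    ι m                        ≈⟨ trans (+-congʳ (-‿inverseˡ 1#)) (+-identityˡ _) ⟨
    (- 1# + 1#) + ι m          ≈⟨ +-assoc _ _ _ ⟩
    - 1# + ν ∎
  ... | no j≢k = trans (trans (sum-cong-≋ {m} λ r → VW j r k)
    (sum-powers (ρⁿ≈1 (toℕ j) (toℕ k)) (ρ-toℕ≉1 j≢k))) (sym (+-identityʳ _))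

  leibniz-VW : leibniz V * leibniz W ≈ ∏ {m} (λ _ → ν) * ν ⁻¹
  leibniz-VW = begin
    leibniz V * leibniz W                            ≈⟨ leibniz-⊗ V W ⟨
    leibniz (V ⊗ W)                                  ≈⟨ leibniz-cong {m} V⊗W ⟩
    leibniz {m} (λ j k → - 1# + diag (λ _ → ν) j k)
      ≈⟨ leibniz-diag+const {m} (λ _ → ν) (λ _ → ν ⁻¹) (λ _ → νν⁻¹≈1) (- 1#) ⟩
    ∏ {m} (λ _ → ν) * (1# + - 1# * sum {m} (λ _ → ν ⁻¹))  ≈⟨ *-congˡ (begin
      -- This is 1 - (n - 1)/n = 1/n, with the leading 1 written as n/n.
      1# + - 1# * sum {m} (λ _ → ν ⁻¹)                 ≈⟨ +-cong (sym νν⁻¹≈1) (*-congˡ (sum-const m (ν ⁻¹))) ⟩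
      (1# + ι m) * ν ⁻¹ + - 1# * (ι m * ν ⁻¹)
        ≈⟨ solve 3 (λ a m w → (con 1 :+ m) :* w :+ a :* (m :* w) := w :+ (con 1 :+ a) :* (m :* w)) refl (- 1#) (ι m) (ν ⁻¹) ⟩
      ν ⁻¹ + (1# + - 1#) * (ι m * ν ⁻¹)
        ≈⟨ trans (+-congˡ (trans (*-congʳ (-‿inverseʳ 1#)) (zeroˡ _))) (+-identityʳ _) ⟩
      ν ⁻¹ ∎) ⟩
    ∏ {m} (λ _ → ν) * ν ⁻¹ ∎

  scaled : Fin m → Carrier
  scaled i = eigenvalue i * ν ⁻¹

  -- On the diagonal the root of unity is 1, where the closed form is undefined; there the sum is Σ
  -- λ_r / n, which vanishes by antisymmetry and so matches the prescribed entry 0.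
  sum-scaled-ρ : ∀ j k → sum (λ r → scaled r * ρ (toℕ j) (toℕ k) ^ suc (toℕ r)) ≈ a ζ j k
  sum-scaled-ρ j k with j Fin.≟ k
  ... | yes ≡.refl = begin
    sum (λ r → scaled r * ρ (toℕ j) (toℕ j) ^ suc (toℕ r))
      ≈⟨ sum-cong-≋ {m} (λ r → trans (*-congˡ (ρ-diagonal (toℕ j) (suc (toℕ r)))) (*-identityʳ _)) ⟩
    sum scaled                      ≈⟨ *-distribʳ-sum (ν ⁻¹) eigenvalue ⟨
    sum eigenvalue * ν ⁻¹           ≈⟨ trans (*-congʳ sum-eigenvalue) (zeroˡ _) ⟩
    0# ∎
  ... | no j≢k = begin
    sum (λ r → scaled r * ρ (toℕ j) (toℕ k) ^ suc (toℕ r))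
      -- The change from `ρ` to `powDiff` is made inside the powers, before 1 - z is inverted,
      -- because `_⁻¹` comes with no congruence.
      ≈⟨ sum-cong-≋ {m} (λ r → trans (*-congˡ (^-cong (suc (toℕ r)) (sym z≈ρ)))
           (solve 3 (λ e w z → (e :* w) :* z := w :* (e :* z)) refl _ _ _)) ⟩
    sum (λ r → ν ⁻¹ * (eigenvalue r * z ^ suc (toℕ r)))
      ≈⟨ *-distribˡ-sum (ν ⁻¹) (λ r → eigenvalue r * z ^ suc (toℕ r)) ⟨
    ν ⁻¹ * sum (λ r → eigenvalue r * z ^ suc (toℕ r))
      ≈⟨ *-congˡ (sum-linear-powers (trans (^-cong n z≈ρ) (ρⁿ≈1 (toℕ j) (toℕ k))) (ρ-toℕ≉1 j≢k ∘ trans (sym z≈ρ))) ⟩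
    ν ⁻¹ * (ν * ((1# + z) * (1# - z) ⁻¹))
      ≈⟨ trans (sym (*-assoc _ _ _)) (trans (*-congʳ (trans (*-comm _ _) νν⁻¹≈1)) (*-identityˡ _)) ⟩
    (1# + z) * (1# - z) ⁻¹ ∎
    where
    z = powDiff ζ (toℕ j) (toℕ k)
    z≈ρ = powDiff≈ρ (toℕ j) (toℕ k)

  -- The factorization of the shifted matrix and its determinant

  module _ (x : Carrier) where
    D : Matrix m
    D r s = x + diag scaled r s

    D⊗W : ∀ r k → (D ⊗ W) r k ≈ - x + scaled r * W r k
    D⊗W r k = begin
      sum (λ s → (x + diag scaled r s) * W s k)                       ≈⟨ sum-cong-≋ {m} (λ s → distribʳ _ _ _) ⟩
      sum (λ s → x * W s k + diag scaled r s * W s k)                 ≈⟨ ∑-distrib-+ {m} _ _ ⟩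
      sum (λ s → x * W s k) + sum (λ s → diag scaled r s * W s k)
        ≈⟨ +-cong (sym (*-distribˡ-sum x (λ s → W s k))) (sum-diagˡ scaled (λ s → W s k) r) ⟩
      x * sum (λ s → W s k) + scaled r * W r k
        ≈⟨ +-congʳ (trans (*-congˡ (sum-W k)) (trans (*-comm _ _) (-1*x≈-x x))) ⟩
      - x + scaled r * W r k ∎

    diagonalization : ∀ j k → (V ⊗ (D ⊗ W)) j k ≈ x + a ζ j k
    diagonalization j k = begin
      sum (λ r → V j r * (D ⊗ W) r k)
        ≈⟨ sum-cong-≋ {m} (λ r → trans (*-congˡ (D⊗W r k)) (trans (distribˡ _ _ _) (+-congˡ (trans
             (solve 3 (λ v e w → v :* (e :* w) := e :* (v :* w)) refl _ _ _) (*-congˡ (VW j r k)))))) ⟩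
      sum (λ r → V j r * - x + scaled r * ρ (toℕ j) (toℕ k) ^ suc (toℕ r))
        ≈⟨ ∑-distrib-+ {m} _ _ ⟩
      sum (λ r → V j r * - x) + sum (λ r → scaled r * ρ (toℕ j) (toℕ k) ^ suc (toℕ r))
        ≈⟨ +-cong (sym (*-distribʳ-sum (- x) (V j))) (sum-scaled-ρ j k) ⟩
      sum (V j) * - x + a ζ j k
        ≈⟨ +-congʳ (trans (*-congʳ (sum-V j)) (trans (-1*x≈-x _) (-‿involutive x))) ⟩
      x + a ζ j k ∎

    leibniz-D : leibniz D ≈ ∏ scaled
    leibniz-D = begin
      leibniz D
        -- The inverse of λ_r / n is supplied as n λ_r⁻¹, so that the sum of inverses is n Σ 1/λ_r =
        -- 0 and `x` disappears.
        ≈⟨ leibniz-diag+const scaled (λ i → ν * eigenvalue i ⁻¹) (λ i → trans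
             (solve 4 (λ e w v u → (e :* w) :* (v :* u) := (e :* u) :* (v :* w)) refl _ _ _ _)
             (trans (*-cong (inverse _ (eigenvalue≉0 i)) νν⁻¹≈1) (*-identityˡ _))) x ⟩
      ∏ scaled * (1# + x * sum (λ i → ν * eigenvalue i ⁻¹))
        ≈⟨ *-congˡ (+-congˡ (*-congˡ (trans (sym (*-distribˡ-sum ν (λ i → eigenvalue i ⁻¹)))
             (trans (*-congˡ sum-eigenvalue⁻¹) (zeroʳ ν))))) ⟩
      ∏ scaled * (1# + x * 0#)
        ≈⟨ trans (*-congˡ (trans (+-congˡ (zeroʳ x)) (+-identityʳ _))) (*-identityʳ _) ⟩
      ∏ scaled ∎

    det-shifted : det m (λ j k → x + a ζ j k) ≈ rhs n
    det-shifted = begin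
      det m (λ j k → x + a ζ j k)                       ≈⟨ det≈leibniz m (λ j k → x + a ζ j k) ⟩
      leibniz {m} (λ j k → x + a ζ j k)                     ≈⟨ leibniz-cong {m} diagonalization ⟨
      leibniz (V ⊗ (D ⊗ W))                             ≈⟨ trans (leibniz-⊗ V (D ⊗ W)) (*-congˡ (leibniz-⊗ D W)) ⟩
      leibniz V * (leibniz D * leibniz W)
        ≈⟨ solve 3 (λ v d w → v :* (d :* w) := (v :* w) :* d) refl _ _ _ ⟩
      (leibniz V * leibniz W) * leibniz D               ≈⟨ *-cong leibniz-VW (trans leibniz-D (∏-distrib {m} _ _)) ⟩
      (∏ {m} (λ _ → ν) * ν ⁻¹) * (∏ eigenvalue * ∏ {m} (λ _ → ν ⁻¹))
        ≈⟨ solve 4 (λ p w e q → (p :* w) :* (e :* q) := (p :* q) :* (e :* w)) refl _ _ _ _ ⟩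
      (∏ {m} (λ _ → ν) * ∏ {m} (λ _ → ν ⁻¹)) * (∏ eigenvalue * ν ⁻¹)
        ≈⟨ trans (*-congʳ (∏ν*∏ν⁻¹≈1 m)) (*-identityˡ _) ⟩
      ∏ eigenvalue * ν ⁻¹                               ≈⟨ trans (*-congʳ (∏-linear h)) (*-assoc _ _ _) ⟩
      (- 1#) ^ h * (ι ((m ∸ 1) !!) ^ 2 * ν ⁻¹)          ≡⟨ ≡.cong (λ t → (- 1#) ^ t * (ι ((m ∸ 1) !!) ^ 2 * ν ⁻¹)) (ℕ.m*n/n≡m h 2) ⟨
      rhs n ∎

  derangementSum≈rhs : derangementSum m (a ζ) ≈ rhs n
  derangementSum≈rhs = begin
    derangementSum m (a ζ)           ≈⟨ derangementSum≈det m (a ζ) zero-diagonal ⟩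
    det m (a ζ)                      ≈⟨ det≈leibniz m (a ζ) ⟩
    leibniz {m} (a ζ)                    ≈⟨ leibniz-cong {m} (λ j k → +-identityˡ (a ζ j k)) ⟨
    leibniz {m} (λ j k → 0# + a ζ j k)   ≈⟨ det≈leibniz m (λ j k → 0# + a ζ j k) ⟨
    det m (λ j k → 0# + a ζ j k)     ≈⟨ det-shifted 0# ⟩
    rhs n ∎
    where
    zero-diagonal : ∀ (i : Fin m) → a ζ i i ≈ 0#
    zero-diagonal i with i Fin.≟ i
    ... | yes _ = refl
    ... | no i≢i = ⊥-elim (i≢i ≡.refl)

theorem1p1 : {c ℓ : Level} (F : Field c ℓ) → FieldOps.CharZero F →
    (n : ℕ) → 1 < n → n % 2 ≡ 1 →
    (ζ : Field.Carrier F) → FieldOps.PrimitiveRoot F n ζ →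
    ((x : Field.Carrier F) →
    Field._≈_ F (FieldOps.det F (n ∸ 1) (λ j k → Field._+_ F x (FieldOps.a F ζ j k)))
    (FieldOps.rhs F n))
    × Field._≈_ F (FieldOps.derangementSum F (n ∸ 1) (FieldOps.a F ζ)) (FieldOps.rhs F n)
theorem1p1 F charZero n _ odd ζ prim
  -- Division by 2 with remainder 1 presents n as `suc (h * 2)`; after the substitution `n ∸ 1`
  -- computes to `h * 2`, the matrix size of `RootsOfUnity`.
  with n ℕ./ 2 | ≡.trans (ℕ.m≡m%n+[m/n]*n n 2) (≡.cong (ℕ._+ n ℕ./ 2 ℕ.* 2) odd)
... | h | ≡.refl = det-shifted , derangementSum≈rhs
  where open RootsOfUnity F charZero h ζ prim
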